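{- Let $r>s\geq 2$ be integers. If $r\geq 2s+1$, then $ex(n,K_r,B_{r,s})=\Theta(n^{r-s-1})$ as $n\to\infty$. If $r\leq 2s$, then there exist positive reals $c_1,c_2$ such that for all sufficiently large $n$, \[ c_1 n^{\beta_{r,s}}\leq ex(n,K_r,B_{r,s})\leq c_2 n^{s}. \]
   Context: For integers $0\le s<r$, $B_{r,s}$ denotes the graph consisting of two copies of $K_r$ that share exactly $s$ vertices. A graph is $F$-free if it contains no subgraph isomorphic to $F$. For graphs $T,F$, $ex(n,T,F)$ denotes the maximum number of copies of $T$ in an $F$-free graph on $n$ vertices. A partition of $r$ is an integer vector $(a_1,\dots,a_t)$ with $a_1\ge a_2\ge\dots\ge a_t>0$ and $\sum_{i=1}^t a_i=r$; its length is $t$. It is $s$-sum-free if $\sum_{i\in I}a_i\neq s$ for every $I\subseteq\{1,\dots,t\}$. $\beta_{r,s}$ denotes the maximum length of an $s$-sum-free partition of $r$. -}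

module Defs where

open import Data.Nat using (ℕ; zero; suc; _+_; _*_; _∸_; _^_; _≤_; _<_; _<ᵇ_; _≤ᵇ_) renaming (_≟_ to _ℕ≟_)
open import Data.Bool using (Bool; true; false; _∧_; _∨_; not)
open import Data.Fin using (Fin; toℕ; _≟_)
open import Data.Fin.Subset using (Subset; ∣_∣)
open import Data.Vec using (Vec; []; _∷_; lookup)
open import Data.List using (List; []; _∷_; [_]; map; _++_; length; filterᵇ; allFin)
open import Data.Bool.ListAction using (and)
open import Data.Nat.ListAction using (sum)
open import Data.List.Relation.Unary.All using (All)
open import Data.List.Relation.Unary.Linked using (Linked)
open import Data.List.Relation.Binary.Sublist.Propositional using (_⊆_)
open import Data.Product using (Σ; ∃; _×_)
open import Function.Definitions using (Injective)
open import Relation.Binary.PropositionalEquality using (_≡_; _≢_)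
open import Relation.Nullary using (¬_)
open import Relation.Nullary.Decidable using (⌊_⌋)

record Graph (n : ℕ) : Set where
  field
    adj    : Fin n → Fin n → Bool
    sym    : ∀ i j → adj i j ≡ adj j i
    irrefl : ∀ i → adj i i ≡ false
open Graph public

ContainsCopy : ∀ {m n} → (Fin m → Fin m → Bool) → Graph n → Set
ContainsCopy {m} {n} fadj G =
  Σ (Fin m → Fin n) λ f → Injective _≡_ _≡_ f ×
    (∀ i j → fadj i j ≡ true → adj G (f i) (f j) ≡ true)

-- B_{r,s}: vertex set Fin (2r - s); vertices 0..r-1 form one K_r,
-- vertices r-s..2r-s-1 form the other K_r; they share the s vertices
-- r-s..r-1.
B-adj : (r s : ℕ) → Fin ((r + r) ∸ s) → Fin ((r + r) ∸ s) → Bool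
B-adj r s i j =
  not ⌊ i ≟ j ⌋ ∧
  (((toℕ i <ᵇ r) ∧ (toℕ j <ᵇ r)) ∨ (((r ∸ s) ≤ᵇ toℕ i) ∧ ((r ∸ s) ≤ᵇ toℕ j)))

B-free : (r s : ℕ) → ∀ {n} → Graph n → Set
B-free r s G = ¬ ContainsCopy (B-adj r s) G

allSubsets : (n : ℕ) → List (Subset n)
allSubsets zero    = [ [] ]
allSubsets (suc n) = map (true ∷_) (allSubsets n) ++ map (false ∷_) (allSubsets n)

isCliqueᵇ : ∀ {n} → Graph n → Subset n → Bool
isCliqueᵇ {n} G S =
  and (map (λ i → and (map (λ j →
         not (lookup S i ∧ lookup S j) ∨ ⌊ i ≟ j ⌋ ∨ adj G i j) (allFin n))) (allFin n))

#K : (r : ℕ) → ∀ {n} → Graph n → ℕ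
#K r {n} G =
  length (filterᵇ (λ S → ⌊ ∣ S ∣ ℕ≟ r ⌋ ∧ isCliqueᵇ G S) (allSubsets n))

IsPartition : ℕ → List ℕ → Set
IsPartition r as = Linked (λ a b → b ≤ a) as × All (λ a → 0 < a) as × sum as ≡ r

-- s-sum-free: no sub-multiset (sublist = choice of an index set I) sums to s
SumFree : ℕ → List ℕ → Set
SumFree s as = ∀ bs → bs ⊆ as → sum bs ≢ s

IsBeta : ℕ → ℕ → ℕ → Set
IsBeta r s b =
  (Σ (List ℕ) λ as → IsPartition r as × SumFree s as × length as ≡ b) ×
  (∀ as → IsPartition r as → SumFree s as → length as ≤ b)

-- ex(n, K_r, B_{r,s}) = Θ-type bounds, unfolded via the definition of max:
--   lower: n^a ≤ C · ex   (some B-free graph G on n vertices has n^a ≤ C · #K r G)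
--   upper: ex ≤ C · n^b   (every B-free graph G on n vertices has #K r G ≤ C · n^b)

ExLower : (r s : ℕ) → (n a C : ℕ) → Set
ExLower r s n a C = Σ (Graph n) λ G → B-free r s G × n ^ a ≤ C * #K r G

ExUpper : (r s : ℕ) → (n b C : ℕ) → Set
ExUpper r s n b C = ∀ (G : Graph n) → B-free r s G → #K r G ≤ C * n ^ b

{-# OPTIONS --safe #-}
module Submission where

-- Upper bound: list every copy of K_r by its r vertices; the agreement sets of pairs of copies lie in
-- an intersection-closed family 𝒞 of subsets of Fin r.  Either some X with ∣ X ∣ ≤ max(s, r - s - 1) is
-- contained in no proper member of 𝒞, and then a copy is determined by its vertices in X; or, by the
-- Frankl–Katona theorem, 𝒞 has a member A of size s.  In the latter case any two copies agreeing on A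
-- share a further vertex (they would span a B_{r,s} otherwise), so comparing every copy with a fixed
-- representative of its restriction to A splits the copies into at most r² classes, on each of which A
-- is no longer an agreement set.  As 𝒞 shrinks, this stops after a number of rounds depending on r only.
--
-- Lower bound: join disjoint unions of copies of K_{a₁}, …, K_{a_t}, where a₁ + … + a_t = r.  A copy of
-- K_r takes one clique from each part, so two of them meet in a subsum of the a_i.

open import Defs hiding (sym)
open import Data.Bool using (Bool; true; false; _∧_; _∨_; not; if_then_else_)
open import Data.Bool.ListAction using (and)
open import Data.Bool.Properties using (T-≡; ∨-zeroʳ) renaming (_≟_ to _𝔹≟_)
open import Data.Empty using (⊥-elim)
open import Data.Fin using (Fin; zero; suc; toℕ; fromℕ<; _≟_; splitAt; cast; _↑ˡ_; _↑ʳ_; punchOut)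
open import Data.Fin.Permutation using (permutation)
open import Data.Fin.Properties
  using (all?; any?; suc-injective; toℕ<n; toℕ-injective; toℕ-fromℕ<; toℕ-cast; toℕ-↑ˡ; toℕ-↑ʳ;
         splitAt-↑ˡ; splitAt-↑ʳ; splitAt⁻¹-↑ˡ; splitAt⁻¹-↑ʳ; punchOut-injective; injective⇒≤)
open import Data.Fin.Subset using (Subset; _∈_; _∉_; _⊆_; _∩_; _-_; ⊤; ⋂; ∁; ∣_∣)
open import Data.Fin.Subset.Properties
  using (_∈?_; _⊆?_; ∈⊤; ∣p∣≤n; ∣∁p∣≡n∸∣p∣; anySubset?; x∈p∩q⁺; x∈p∩q⁻; p∩q⊆p; p∩q⊆q; x∈∁p⇒x∉p;
         x∈p∧x≢y⇒x∈p-y; x∈p⇒∣p-x∣<∣p∣; ⊆-antisym)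
open import Data.List
  using (List; []; _∷_; length; map; filter; filterᵇ; tabulate; allFin; upTo; replicate;
         cartesianProduct; cartesianProductWith)
open import Data.List.Properties
  using (length-++; length-map; length-filter; length-tabulate; length-upTo; length-replicate)
open import Data.List.Membership.Propositional using () renaming (_∈_ to _∈ₗ_)
open import Data.List.Membership.Propositional.Properties
  using (∈-filter⁺; ∈-filter⁻; ∈-map⁺; ∈-map⁻; ∈-++⁺ˡ; ∈-++⁺ʳ; ∈-allFin; ∈-upTo⁻; ∈-length;
         ∈-cartesianProduct⁺; ∈-cartesianProduct⁻; ∈-cartesianProductWith⁻)
open import Data.List.Relation.Binary.Sublist.Propositional using ([]; _∷_; _∷ʳ_) renaming (_⊆_ to _⊑_)
import Data.List.Relation.Binary.Sublist.Propositional.Properties as Sublist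
open import Data.List.Relation.Unary.All using (All; []; _∷_)
open import Data.List.Relation.Unary.All.Properties using (tabulate⁺; tabulate⁻; replicate⁺)
open import Data.List.Relation.Unary.AllPairs using ([]; _∷_)
open import Data.List.Relation.Unary.Any using (here; there)
open import Data.List.Relation.Unary.Unique.Propositional using (Unique)
open import Data.List.Relation.Unary.Unique.Propositional.Properties
  using (filter⁺; map⁺; ++⁺; upTo⁺; cartesianProductWith⁺)
open import Data.Nat
  using (ℕ; zero; suc; _+_; _*_; _∸_; _^_; _≤_; _<_; _≤ᵇ_; _<ᵇ_; _≤?_; _<?_; z≤n; s≤s; s≤s⁻¹;
         _/_; _%_; _!; NonZero; >-nonZero)
open import Data.Nat.Divisibility using (∣-trans; m∣m*n; n∣m*n; m≤n⇒m!∣n!)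
open import Data.Nat.DivMod
  using (_mod_; /-monoʳ-≤; m/n*n≤m; m*[n/m]≡n; m≡m%n+[m/n]*n; [m+kn]%n≡m%n; m<n⇒m%n≡m; m<n⇒m/n≡0;
         m*n/n≡m; +-distrib-/-∣ʳ; m%n<n; m%n≤n; m≥n⇒m/n>0)
open import Data.Nat.ListAction using () renaming (sum to sumₗ)
open import Data.Nat.Properties hiding (_≟_; ≡-irrelevant; suc-injective)
import Data.Nat.Properties as ℕ
open import Data.Nat.Solver using (module +-*-Solver)
open import Data.Product using (∃; ∃₂; _×_; _,_; proj₁; proj₂)
open import Data.Sum using (_⊎_; inj₁; inj₂; [_,_]′; map₂)
open import Data.Vec as Vec using (Vec; []; _∷_; lookup)
open import Data.Vec.Properties
  using (lookup⇒[]=; []=⇒lookup; lookup∘tabulate; tabulate∘lookup; tabulate-cong; lookup-map;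
         toList-map; length-toList; ∷-injective; ∷-injectiveʳ; ≡-dec)
open import Function using (_∘_; id)
open import Function.Bundles using (Equivalence)
open import Relation.Binary.PropositionalEquality
open import Relation.Nullary using (¬_; Dec; yes; no; does; contradiction)
open import Relation.Nullary.Decidable
  using (⌊_⌋; dec-true; dec-false; ¬?; _×-dec_; _→-dec_; decidable-stable; isYes≗does)
open import Relation.Unary using (Decidable)

open import Algebra.Properties.Semiring.Sum +-*-semiring
  using (sum; sum-cong-≗; sum-permute; sum-replicate-zero; ∑-distrib-+; ∑-comm; *-distribˡ-sum; *-distribʳ-sum)

-- Counting with Boolean predicates

-- The obstacle in the upper bound is that an agreement set records only the vertices with the same
-- index in both copies, while two copies may also share a vertex at different indices. So
-- B-freeness does not keep agreement sets from having size s, and the Frankl-Katona theorem gives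
-- no contradiction by itself. The further vertex that a copy shares with its representative has an
-- index i outside A in the copy and an index j, possibly different, in the representative. Once (i,
-- j) is fixed, all copies with that representative have the same vertex at i: a coincidence across
-- indices has become a genuine agreement. Starting from all subsets of `Fin r`, at most 2^r rounds
-- can occur, each costing a factor of at most r². In the lower bound for r ≥ 2s + 1 the partition
-- is (s + 1, 1, ..., 1), although s of its ones sum to s. It works because its large part consists
-- of a single clique, so that this clique belongs to every intersection of two copies.

does⁻ : ∀ {ℓ} {P : Set ℓ} (d : Dec P) → does d ≡ true → P
does⁻ (yes p) _ = p

true≢false : true ≢ false
true≢false ()

∧⁺ : ∀ {a b} → a ≡ true → b ≡ true → a ∧ b ≡ true
∧⁺ refl refl = refl

∧⁻ : ∀ {a b} → a ∧ b ≡ true → a ≡ true × b ≡ true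
∧⁻ {true} {true} _ = refl , refl

not⁺ : ∀ {a} → ¬ (a ≡ true) → not a ≡ true
not⁺ {false} _ = refl
not⁺ {true} h = contradiction refl h

not⁻ : ∀ {a} → not a ≡ true → ¬ (a ≡ true)
not⁻ {false} _ ()

⟦_⟧ : Bool → ℕ
⟦ true ⟧ = 1
⟦ false ⟧ = 0

⟦⟧-mono : ∀ {a b} → (a ≡ true → b ≡ true) → ⟦ a ⟧ ≤ ⟦ b ⟧
⟦⟧-mono {false} h = z≤n
⟦⟧-mono {true} h rewrite h refl = ≤-refl

⟦⟧-cong : ∀ {a b} → (a ≡ true → b ≡ true) → (b ≡ true → a ≡ true) → ⟦ a ⟧ ≡ ⟦ b ⟧
⟦⟧-cong f g = ≤-antisym (⟦⟧-mono f) (⟦⟧-mono g)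

⟦⟧-⊎ : ∀ {a b c} → (a ≡ true → b ≡ true ⊎ c ≡ true) → (b ≡ true → a ≡ true) →
       (c ≡ true → a ≡ true) → ¬ (b ≡ true × c ≡ true) → ⟦ a ⟧ ≡ ⟦ b ⟧ + ⟦ c ⟧
⟦⟧-⊎ {_} {true} {true} _ _ _ h = contradiction (refl , refl) h
⟦⟧-⊎ {_} {true} {false} _ f _ _ rewrite f refl = refl
⟦⟧-⊎ {_} {false} {true} _ _ f _ rewrite f refl = refl
⟦⟧-⊎ {false} {false} {false} _ _ _ _ = refl
⟦⟧-⊎ {true} {false} {false} h _ _ _ with h refl
... | inj₁ ()
... | inj₂ ()

sum-mono : ∀ {n} {f g : Fin n → ℕ} → (∀ i → f i ≤ g i) → sum f ≤ sum g
sum-mono {zero} h = z≤n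
sum-mono {suc n} h = +-mono-≤ (h zero) (sum-mono (h ∘ suc))

#_ : ∀ {n} → (Fin n → Bool) → ℕ
# p = sum (λ i → ⟦ p i ⟧)

#-mono : ∀ {n} {p q : Fin n → Bool} → (∀ i → p i ≡ true → q i ≡ true) → # p ≤ # q
#-mono h = sum-mono (λ i → ⟦⟧-mono (h i))

#-cong : ∀ {n} {p q : Fin n → Bool} → (∀ i → p i ≡ true → q i ≡ true) →
         (∀ i → q i ≡ true → p i ≡ true) → # p ≡ # q
#-cong f g = ≤-antisym (#-mono f) (#-mono g)

#-⊎ : ∀ {n} {p q t : Fin n → Bool} → (∀ i → p i ≡ true → q i ≡ true ⊎ t i ≡ true) →
      (∀ i → q i ≡ true → p i ≡ true) → (∀ i → t i ≡ true → p i ≡ true) →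
      (∀ i → ¬ (q i ≡ true × t i ≡ true)) → # p ≡ # q + # t
#-⊎ {q = q} {t} f g h k =
  trans (sum-cong-≗ (λ i → ⟦⟧-⊎ (f i) (g i) (h i) (k i))) (∑-distrib-+ (⟦_⟧ ∘ q) (⟦_⟧ ∘ t))

#-≡0 : ∀ {n} {p : Fin n → Bool} → (∀ i → ¬ p i ≡ true) → # p ≡ 0
#-≡0 {n} h = n≤0⇒n≡0 (≤-trans (#-mono {q = λ _ → false} (λ i e → contradiction e (h i)))
                               (≤-reflexive (sum-replicate-zero n)))

#-true : ∀ {n} {p : Fin n → Bool} → (∀ i → p i ≡ true) → # p ≡ n
#-true {zero} h = refl
#-true {suc n} h rewrite h zero = cong suc (#-true (h ∘ suc))

#≤n : ∀ {n} (p : Fin n → Bool) → # p ≤ n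
#≤n {n} p = ≤-trans (#-mono {p = p} {λ _ → true} (λ _ _ → refl)) (≤-reflexive (#-true {n} (λ _ → refl)))

∃⇒#>0 : ∀ {n} {p : Fin n → Bool} i → p i ≡ true → 1 ≤ # p
∃⇒#>0 {p = p} zero e rewrite e = s≤s z≤n
∃⇒#>0 {p = p} (suc i) e = m≤n⇒m≤o+n ⟦ p zero ⟧ (∃⇒#>0 {p = p ∘ suc} i e)

#>0⇒∃ : ∀ {n} {p : Fin n → Bool} → 1 ≤ # p → ∃ λ i → p i ≡ true
#>0⇒∃ {p = p} h with any? (λ i → p i 𝔹≟ true)
... | yes r = r
... | no ¬r = contradiction (#-≡0 (λ i e → ¬r (i , e))) (≢-sym (<⇒≢ h))

δ : ∀ {n} → Fin n → Fin n → Bool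
δ i j = does (i ≟ j)

#-δ : ∀ {n} (i : Fin n) → # δ i ≡ 1
#-δ {suc n} zero = cong suc (#-≡0 {n} {λ j → δ zero (suc j)} (λ i ()))
#-δ (suc i) = trans (sum-cong-≗ (λ j → ⟦⟧-cong
  (λ e → dec-true (i ≟ j) (suc-injective (does⁻ (suc i ≟ suc j) e)))
  (λ e → dec-true (suc i ≟ suc j) (cong suc (does⁻ (i ≟ j) e))))) (#-δ i)

_∖_ : ∀ {n} → (Fin n → Bool) → Fin n → Fin n → Bool
(p ∖ z) i = p i ∧ not (δ z i)

#-∖ : ∀ {n} {p : Fin n → Bool} z → p z ≡ true → # p ≡ suc (# (p ∖ z))
#-∖ {p = p} z pz = trans
  (#-⊎ {t = δ z}
    (λ i pi → split i pi (z ≟ i)) (λ i e → proj₁ (∧⁻ e))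
    (λ i e → subst (λ j → p j ≡ true) (does⁻ (z ≟ i) e) pz)
    (λ i (a , b) → not⁻ {δ z i} (proj₂ (∧⁻ {p i} a)) b))
  (trans (cong (# (p ∖ z) +_) (#-δ z)) (+-comm _ 1))
  where
  split : ∀ i → p i ≡ true → Dec (z ≡ i) → (p ∖ z) i ≡ true ⊎ δ z i ≡ true
  split i pi (yes e) = inj₂ (dec-true (z ≟ i) e)
  split i pi (no ¬e) = inj₁ (∧⁺ pi (not⁺ (¬e ∘ does⁻ (z ≟ i))))

-- Double counting with the weight L / h on rows and columns of size h.
dbe : ∀ {a b} (H : Fin a → Fin b → Bool) (X : Fin a → Bool) (R : Fin b → Bool) →
      (∀ z v → H z v ≡ true → # (λ y → H y v) ≤ # H z) →
      (∀ z → X z ≡ true → ∃ λ v → H z v ≡ true) →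
      (∀ z v → H z v ≡ true → R v ≡ true) → # X ≤ # R
dbe {a} {b} H X R col≤row row≥1 H⇒R = *-cancelˡ-≤ L (begin
  L * # X                                        ≡⟨ *-distribˡ-sum L (⟦_⟧ ∘ X) ⟩
  sum (λ z → L * ⟦ X z ⟧)                        ≤⟨ sum-mono row ⟩
  sum (λ z → sum (λ v → ⟦ H z v ⟧ * u (# H z)))  ≤⟨ sum-mono (λ z → sum-mono (weights z)) ⟩
  sum (λ z → sum (λ v → ⟦ H z v ⟧ * u (col v)))  ≡⟨ ∑-comm (λ z v → ⟦ H z v ⟧ * u (col v)) ⟩
  sum (λ v → sum (λ z → ⟦ H z v ⟧ * u (col v)))  ≤⟨ sum-mono column ⟩
  sum (λ v → L * ⟦ R v ⟧)                        ≡⟨ *-distribˡ-sum L (⟦_⟧ ∘ R) ⟨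
  L * # R                                        ∎)
  where
  open ≤-Reasoning
  -- Clears denominators: every row size divides this factorial, so `L / h` is exact on rows. On
  -- columns an upper bound is wanted, so rounding down does no harm.
  L = (a + b) !
  instance L≢0 = (a + b) !≢0
  u : ℕ → ℕ
  -- Junk value: it is only ever multiplied by 0.
  u zero = 0
  u (suc h) = L / suc h
  col : Fin b → ℕ
  col v = # (λ z → H z v)

  u-exact : ∀ h → 1 ≤ h → h ≤ b → h * u h ≡ L
  u-exact (suc h) _ h≤b =
    m*[n/m]≡n (∣-trans (m∣m*n (h !)) (m≤n⇒m!∣n! (≤-trans h≤b (m≤n+m b a))))

  u-anti : ∀ {h k} → 1 ≤ h → h ≤ k → u k ≤ u h
  u-anti {suc h} {suc k} _ h≤k = /-monoʳ-≤ L h≤k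

  u-bound : ∀ h → h * u h ≤ L
  u-bound zero = z≤n
  u-bound (suc h) = ≤-trans (≤-reflexive (*-comm (suc h) (L / suc h))) (m/n*n≤m L (suc h))

  row : ∀ z → L * ⟦ X z ⟧ ≤ sum (λ v → ⟦ H z v ⟧ * u (# H z))
  row z with X z in e
  ... | false rewrite *-zeroʳ L = z≤n
  ... | true = ≤-reflexive (trans (*-identityʳ L) (trans
        (sym (u-exact (# H z) (let (v , hv) = row≥1 z e in ∃⇒#>0 v hv) (#≤n (H z))))
        (*-distribʳ-sum (u (# H z)) (⟦_⟧ ∘ H z))))

  weights : ∀ z v → ⟦ H z v ⟧ * u (# H z) ≤ ⟦ H z v ⟧ * u (col v)
  weights z v with H z v in e
  ... | false = z≤n
  ... | true = *-monoʳ-≤ 1 (u-anti (∃⇒#>0 {p = λ y → H y v} z e) (col≤row z v e))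

  column : ∀ v → sum (λ z → ⟦ H z v ⟧ * u (col v)) ≤ L * ⟦ R v ⟧
  column v = subst (_≤ L * ⟦ R v ⟧) (*-distribʳ-sum (u (col v)) (λ z → ⟦ H z v ⟧)) bound
    where
    bound : col v * u (col v) ≤ L * ⟦ R v ⟧
    bound with R v in e
    ... | true = ≤-trans (u-bound (col v)) (≤-reflexive (sym (*-identityʳ L)))
    ... | false rewrite #-≡0 {p = λ z → H z v}
                          (λ z h → true≢false (trans (sym (H⇒R z v h)) e)) = z≤n

-- The Frankl-Katona theorem for an incidence relation

module FranklKatona {a b} (inc : Fin a → Fin b → Bool) where

  Traps : (Fin a → Bool) → (Fin a → Bool) → Fin b → Set
  Traps X W v = ∀ x → X x ≡ true → inc x v ≡ true → W x ≡ true

  traps? : ∀ X W v → Dec (Traps X W v)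
  traps? X W v = all? (λ x → X x 𝔹≟ true →-dec (inc x v 𝔹≟ true →-dec W x 𝔹≟ true))

  trapped : (X : Fin a → Bool) (R : Fin b → Bool) (W : Fin a → Bool) → Fin b → Bool
  trapped X R W v = R v ∧ does (traps? X W v)

  trapped⁺ : ∀ {X R W v} → R v ≡ true → Traps X W v → trapped X R W v ≡ true
  trapped⁺ {X} {R} {W} {v} rv h = ∧⁺ rv (dec-true (traps? X W v) h)

  trapped⁻ : ∀ {X R W v} → trapped X R W v ≡ true → R v ≡ true × Traps X W v
  trapped⁻ {X} {R} {W} {v} e = let (rv , h) = ∧⁻ {R v} e in rv , does⁻ (traps? X W v) h

  degree : (Fin b → Bool) → Fin a → ℕ
  degree R z = # (λ v → R v ∧ inc z v)

  Hits : (Fin a → Bool) → (Fin b → Bool) → ℕ → Set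
  Hits X R s = ∃ λ W → (∀ x → W x ≡ true → X x ≡ true) × # W + # trapped X R W ≡ s

  -- Growing W from the empty set to X moves the count in `Hits` from at most `# R` to `# X + # R`,
  -- hence past s. But one new element of W can trap several vertices at once and jump over s; the
  -- content is that some W hits s exactly. The induction is on a bound k for `# X`.
  IH : ℕ → Set
  IH k = ∀ X R s → # X ≤ k → # R ≤ s → s < # X → Hits X R s

  -- Contract T and delete z: W consists of T and a solution of the reduced problem.
  step : ∀ {k} → IH k → ∀ X R s → # X ≤ suc k →
         ∀ T z → (∀ x → T x ≡ true → X x ≡ true) → X z ≡ true → ¬ T z ≡ true →
         suc s < # X + # trapped X R T → # R + # T ≤ s + degree R z → Hits X R s
  step {k} ih X R s X≤ T z T⊆X zX z∉T gap room =
    lift (ih X₁ R₁ s₁ X₁≤k R₁≤s₁ s₁<X₁)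
    where
    X₀ = λ x → X x ∧ not (T x)
    X₁ = X₀ ∖ z
    -- As z stays outside W, nothing incident with z can be trapped. What T traps is trapped by
    -- every W containing T, and is counted once and for all in `e`.
    R₀ = λ v → R v ∧ not (inc z v)
    R₁ = λ v → R₀ v ∧ not (does (traps? X T v))
    t = # T
    e = # trapped X R T
    d = degree R z

    X₁⁻ : ∀ {x} → X₁ x ≡ true → X x ≡ true × ¬ T x ≡ true × ¬ z ≡ x
    X₁⁻ {x} h = let (h₀ , h₁) = ∧⁻ {X₀ x} h ; (xX , xT) = ∧⁻ {X x} h₀ in
      xX , not⁻ xT , λ z≡x → not⁻ {δ z x} h₁ (dec-true (z ≟ x) z≡x)

    X₁⁺ : ∀ {x} → X x ≡ true → ¬ T x ≡ true → ¬ z ≡ x → X₁ x ≡ true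
    X₁⁺ {x} xX xT z≢x = ∧⁺ (∧⁺ xX (not⁺ xT)) (not⁺ (z≢x ∘ does⁻ (z ≟ x)))

    R₁⁻ : ∀ {v} → R₁ v ≡ true → R v ≡ true × ¬ inc z v ≡ true × ¬ Traps X T v
    R₁⁻ {v} h = let (h₀ , h₁) = ∧⁻ {R₀ v} h ; (vR , zv) = ∧⁻ {R v} h₀ in
      vR , not⁻ zv , λ tr → not⁻ {does (traps? X T v)} h₁ (dec-true (traps? X T v) tr)

    R₁⁺ : ∀ {v} → R v ≡ true → ¬ inc z v ≡ true → ¬ Traps X T v → R₁ v ≡ true
    R₁⁺ {v} vR zv ¬tr = ∧⁺ (∧⁺ vR (not⁺ zv)) (not⁺ (¬tr ∘ does⁻ (traps? X T v)))

    #X : # X ≡ suc (# X₁) + t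
    #X = trans
      (#-⊎ {p = X} {X₀} {T} (λ x xX → [X] x xX (T x 𝔹≟ true)) (λ x → proj₁ ∘ ∧⁻) T⊆X
        (λ x (h , xT) → not⁻ (proj₂ (∧⁻ {X x} h)) xT))
      (cong (_+ t) (#-∖ {p = X₀} z (∧⁺ zX (not⁺ z∉T))))
      where
      [X] : ∀ x → X x ≡ true → Dec (T x ≡ true) → X₀ x ≡ true ⊎ T x ≡ true
      [X] x xX (yes xT) = inj₂ xT
      [X] x xX (no ¬xT) = inj₁ (∧⁺ xX (not⁺ ¬xT))

    #R : # R ≡ (# R₁ + e) + d
    #R = trans
      (#-⊎ {p = R} {R₀} {λ v → R v ∧ inc z v} (λ v vR → [R] v vR (inc z v 𝔹≟ true))
        (λ v → proj₁ ∘ ∧⁻) (λ v → proj₁ ∘ ∧⁻)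
        (λ v (h , h₁) → not⁻ (proj₂ (∧⁻ {R v} h)) (proj₂ (∧⁻ {R v} h₁))))
      (cong (_+ d) (#-⊎ {p = R₀} {R₁} {trapped X R T}
        (λ v h → [R₀] v h (traps? X T v)) (λ v → proj₁ ∘ ∧⁻)
        (λ v h → let (vR , tr) = trapped⁻ {X} {R} {T} h in ∧⁺ vR (not⁺ (λ zv → z∉T (tr z zX zv))))
        (λ v (h , h₁) → proj₂ (proj₂ (R₁⁻ {v} h)) (proj₂ (trapped⁻ {X} {R} {T} h₁)))))
      where
      [R] : ∀ v → R v ≡ true → Dec (inc z v ≡ true) → R₀ v ≡ true ⊎ (R v ∧ inc z v) ≡ true
      [R] v vR (yes zv) = inj₂ (∧⁺ vR zv)
      [R] v vR (no ¬zv) = inj₁ (∧⁺ vR (not⁺ ¬zv))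
      [R₀] : ∀ v → R₀ v ≡ true → Dec (Traps X T v) → R₁ v ≡ true ⊎ trapped X R T v ≡ true
      [R₀] v h (yes tr) = inj₂ (trapped⁺ {X} {R} {T} (proj₁ (∧⁻ {R v} h)) tr)
      [R₀] v h (no ¬tr) = inj₁ (∧⁺ h (not⁺ (¬tr ∘ does⁻ (traps? X T v))))

    room₁ : # R₁ + (t + e) ≤ s
    room₁ = +-cancelʳ-≤ d _ _ (≤-trans (≤-reflexive (trans
      (solve 4 (λ r t e d → r :+ (t :+ e) :+ d := ((r :+ e) :+ d) :+ t) refl (# R₁) t e d)
      (cong (_+ t) (sym #R)))) room)
      where open +-*-Solver

    -- T and the vertices it traps account for t + e of the required s. `room` and `gap` are the two
    -- bounds of the reduced problem expressed in the original sizes; the second unit in `gap` pays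
    -- for z, which leaves X without entering W.
    s₁ = s ∸ (t + e)

    s≡ : s₁ + (t + e) ≡ s
    s≡ = m∸n+n≡m (≤-trans (m≤n+m _ (# R₁)) room₁)

    R₁≤s₁ : # R₁ ≤ s₁
    R₁≤s₁ = +-cancelʳ-≤ (t + e) _ _ (≤-trans room₁ (≤-reflexive (sym s≡)))

    s₁<X₁ : s₁ < # X₁
    s₁<X₁ = +-cancelʳ-≤ (suc (t + e)) _ _ (≤-trans
      (≤-reflexive (trans (+-suc (suc s₁) (t + e)) (cong (λ m → 2 + m) s≡)))
      (≤-trans gap (≤-reflexive (trans (cong (_+ e) #X)
        (solve 3 (λ x t e → (con 1 :+ x :+ t) :+ e := x :+ (con 1 :+ (t :+ e))) refl (# X₁) t e)))))
      where open +-*-Solver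

    X₁≤k : # X₁ ≤ k
    X₁≤k = ≤-trans (m≤m+n _ t) (s≤s⁻¹ (≤-trans (≤-reflexive (sym #X)) X≤))

    lift : Hits X₁ R₁ s₁ → Hits X R s
    lift (W₁ , W₁⊆ , W₁#) = W , W⊆X , trans (cong₂ _+_ #W #trapped) (trans
      (solve 4 (λ w t r e → (w :+ t) :+ (r :+ e) := (w :+ r) :+ (t :+ e)) refl
        (# W₁) t (# trapped X₁ R₁ W₁) e)
      (trans (cong (_+ (t + e)) W₁#) s≡))
      where
      open +-*-Solver
      W = λ x → W₁ x ∨ T x

      ∨⁻ : ∀ x → W x ≡ true → W₁ x ≡ true ⊎ T x ≡ true
      ∨⁻ x h with W₁ x
      ... | true = inj₁ refl
      ... | false = inj₂ h
      ∨⁺₁ : ∀ {x} → W₁ x ≡ true → W x ≡ true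
      ∨⁺₁ {x} h rewrite h = refl
      ∨⁺₂ : ∀ {x} → T x ≡ true → W x ≡ true
      ∨⁺₂ {x} h with W₁ x
      ... | true = refl
      ... | false = h

      W⊆X : ∀ x → W x ≡ true → X x ≡ true
      W⊆X x h with ∨⁻ x h
      ... | inj₁ w = proj₁ (X₁⁻ {x} (W₁⊆ x w))
      ... | inj₂ xT = T⊆X x xT

      z∉W : ¬ W z ≡ true
      z∉W h with ∨⁻ z h
      ... | inj₁ w = proj₂ (proj₂ (X₁⁻ {z} (W₁⊆ z w))) refl
      ... | inj₂ zT = z∉T zT

      #W : # W ≡ # W₁ + t
      #W = #-⊎ {p = W} {W₁} {T} ∨⁻ (λ x → ∨⁺₁ {x}) (λ x → ∨⁺₂ {x})
             (λ x (w , xT) → proj₁ (proj₂ (X₁⁻ {x} (W₁⊆ x w))) xT)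

      shrink : ∀ v → Traps X W v → Traps X₁ W₁ v
      shrink v tr x xX₁ xv with X₁⁻ {x} xX₁
      ... | xX , x∉T , _ with ∨⁻ x (tr x xX xv)
      ... | inj₁ w = w
      ... | inj₂ xT = contradiction xT x∉T

      grow : ∀ v → ¬ inc z v ≡ true → Traps X₁ W₁ v → Traps X W v
      grow v ¬zv tr x xX xv with T x 𝔹≟ true
      ... | yes xT = ∨⁺₂ {x} xT
      ... | no ¬xT = ∨⁺₁ {x} (tr x (X₁⁺ {x} xX ¬xT (λ { refl → ¬zv xv })) xv)

      #trapped : # trapped X R W ≡ # trapped X₁ R₁ W₁ + e
      #trapped = #-⊎ {p = trapped X R W} {trapped X₁ R₁ W₁} {trapped X R T}
        (λ v h → let (vR , tr) = trapped⁻ {X} {R} {W} h in cases v vR tr (traps? X T v))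
        (λ v h → let (vR₁ , tr) = trapped⁻ {X₁} {R₁} {W₁} h ; (vR , ¬zv , _) = R₁⁻ {v} vR₁ in
                 trapped⁺ {X} {R} {W} vR (grow v ¬zv tr))
        (λ v h → let (vR , tr) = trapped⁻ {X} {R} {T} h in
                 trapped⁺ {X} {R} {W} vR (λ x xX xv → ∨⁺₂ {x} (tr x xX xv)))
        (λ v (h , h₁) → proj₂ (proj₂ (R₁⁻ {v} (proj₁ (trapped⁻ {X₁} {R₁} {W₁} h))))
                              (proj₂ (trapped⁻ {X} {R} {T} h₁)))
        where
        cases : ∀ v → R v ≡ true → Traps X W v → Dec (Traps X T v) →
                trapped X₁ R₁ W₁ v ≡ true ⊎ trapped X R T v ≡ true
        cases v vR tr (yes trT) = inj₂ (trapped⁺ {X} {R} {T} vR trT)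
        cases v vR tr (no ¬trT) = inj₁ (trapped⁺ {X₁} {R₁} {W₁}
          (R₁⁺ {v} vR (λ zv → z∉W (tr z zX zv)) ¬trT) (shrink v tr))

  -- The Frankl–Katona theorem.  If # X = 1 + s and some z ∈ X is incident with all of R, take W = X ∖ z.
  -- Otherwise dbe, applied to non-incidence, yields z and v to which step applies with T = nbhd v.
  fk : ∀ k → IH k
  fk zero X R s X≤ _ s<X = contradiction (≤-trans s<X X≤) (λ ())
  fk (suc k) X R s X≤ R≤s s<X with suc (suc s) ≤? # X
  -- X has an element to spare, so any z can be discarded, with T empty.
  ... | yes 2+s≤X = step (fk k) X R s X≤ (λ _ → false) z (λ _ ()) zX (λ ())
          (≤-trans 2+s≤X (m≤m+n _ _))
          (≤-trans (≤-reflexive (trans (cong (# R +_) (#-≡0 {p = λ (_ : Fin a) → false} (λ _ ()))) (+-identityʳ _)))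
                   (≤-trans R≤s (m≤m+n s _)))
    where
    z = proj₁ (#>0⇒∃ {p = X} (≤-trans (s≤s z≤n) s<X))
    zX = proj₂ (#>0⇒∃ {p = X} (≤-trans (s≤s z≤n) s<X))
  ... | no ¬2+s≤X = tight
    where
    X≡ : # X ≡ suc s
    X≡ = ≤-antisym (s≤s⁻¹ (≰⇒> ¬2+s≤X)) s<X

    H : Fin a → Fin b → Bool
    H z v = (X z ∧ R v) ∧ not (inc z v)

    H⁻ : ∀ {z v} → H z v ≡ true → X z ≡ true × R v ≡ true × ¬ inc z v ≡ true
    H⁻ {z} {v} h = let (h₀ , h₁) = ∧⁻ {X z ∧ R v} h ; (zX , vR) = ∧⁻ {X z} h₀ in
      zX , vR , not⁻ h₁

    nbhd : Fin b → Fin a → Bool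
    nbhd v x = X x ∧ inc x v

    good? : ∀ z v → Dec (H z v ≡ true × # R + # nbhd v ≤ s + degree R z)
    good? z v = (H z v 𝔹≟ true) ×-dec (# R + # nbhd v ≤? s + degree R z)

    universal? : ∀ z → Dec (X z ≡ true × (∀ v → R v ≡ true → inc z v ≡ true))
    universal? z = (X z 𝔹≟ true) ×-dec all? (λ v → R v 𝔹≟ true →-dec inc z v 𝔹≟ true)

    tight : Hits X R s
    tight with any? universal?
    ... | yes (z , zX , univ) = X ∖ z , (λ x → proj₁ ∘ ∧⁻) ,
          trans (cong (# (X ∖ z) +_) (#-≡0 {p = trapped X R (X ∖ z)} none))
                (trans (+-identityʳ _) (ℕ.suc-injective (trans (sym (#-∖ {p = X} z zX)) X≡)))
      where
      none : ∀ v → ¬ trapped X R (X ∖ z) v ≡ true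
      none v h = let (vR , tr) = trapped⁻ {X} {R} {X ∖ z} h in
        not⁻ {δ z z} (proj₂ (∧⁻ {X z} (tr z zX (univ v vR)))) (dec-true (z ≟ z) refl)
    ... | no ¬univ with any? (λ z → any? (good? z))
    -- `nbhd v` traps v itself, which supplies the unit that `gap` lacks when `# X` is only s + 1.
    ... | yes (z , v , h , room) = let (zX , vR , ¬zv) = H⁻ {z} {v} h in
          step (fk k) X R s X≤ (nbhd v) z (λ x → proj₁ ∘ ∧⁻) zX (¬zv ∘ proj₂ ∘ ∧⁻ {X z})
            (≤-trans (≤-reflexive (trans (cong suc (sym X≡)) (+-comm 1 (# X))))
              (+-monoʳ-≤ (# X) (∃⇒#>0 {p = trapped X R (nbhd v)} v
                (trapped⁺ {X} {R} {nbhd v} vR (λ x → ∧⁺)))))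
            room
    ... | no ¬good = contradiction (≤-trans s<X (≤-trans (dbe H X R col≤row row≥1 H⇒R) R≤s)) (<-irrefl refl)
      where
      H⇒R : ∀ z v → H z v ≡ true → R v ≡ true
      H⇒R z v h = proj₁ (proj₂ (H⁻ {z} {v} h))

      row≥1 : ∀ z → X z ≡ true → ∃ λ v → H z v ≡ true
      row≥1 z zX with any? (λ v → H z v 𝔹≟ true)
      ... | yes r = r
      ... | no ¬r = contradiction (z , zX , univ) ¬univ
        where
        univ : ∀ v → R v ≡ true → inc z v ≡ true
        univ v vR with inc z v 𝔹≟ true
        ... | yes zv = zv
        ... | no ¬zv = contradiction (v , ∧⁺ (∧⁺ zX vR) (not⁺ ¬zv)) ¬r

      -- The failure of `room` at a non-incident pair reads, after passing to complements in X and R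
      -- and using `# X` = s + 1, as column size ≤ row size. This is the comparison in Conway's
      -- proof of the de Bruijn-Erdős theorem.
      col≤row : ∀ z v → H z v ≡ true → # (λ y → H y v) ≤ # H z
      col≤row z v h = +-cancelʳ-≤ (N + d) _ _ (begin
        # (λ y → H y v) + (N + d)   ≡⟨ +-assoc (# (λ y → H y v)) N d ⟨
        # (λ y → H y v) + N + d     ≡⟨ cong (_+ d) #X ⟨
        # X + d                     ≡⟨ cong (_+ d) X≡ ⟩
        suc (s + d)                 ≤⟨ ≰⇒> (λ room → ¬good (z , v , h , room)) ⟩
        # R + N                     ≡⟨ cong (_+ N) #R ⟩
        # H z + d + N               ≡⟨ +-assoc (# H z) d N ⟩
        # H z + (d + N)             ≡⟨ cong (# H z +_) (+-comm d N) ⟩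
        # H z + (N + d)             ∎)
        where
        open ≤-Reasoning
        N = # nbhd v
        d = degree R z
        zX = proj₁ (H⁻ {z} {v} h)
        vR = proj₁ (proj₂ (H⁻ {z} {v} h))
        #X : # X ≡ # (λ y → H y v) + N
        #X = #-⊎ {p = X} {λ y → H y v} {nbhd v} (λ y yX → cases y yX (inc y v 𝔹≟ true))
          (λ y hy → proj₁ (H⁻ {y} {v} hy)) (λ y → proj₁ ∘ ∧⁻)
          (λ y (hy , n) → proj₂ (proj₂ (H⁻ {y} {v} hy)) (proj₂ (∧⁻ {X y} n)))
          where
          cases : ∀ y → X y ≡ true → Dec (inc y v ≡ true) → H y v ≡ true ⊎ nbhd v y ≡ true
          cases y yX (yes i) = inj₂ (∧⁺ yX i)
          cases y yX (no ¬i) = inj₁ (∧⁺ (∧⁺ yX vR) (not⁺ ¬i))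
        #R : # R ≡ # H z + d
        #R = #-⊎ {p = R} {H z} {λ w → R w ∧ inc z w} (λ w wR → cases w wR (inc z w 𝔹≟ true))
          (λ w hw → proj₁ (proj₂ (H⁻ {z} {w} hw))) (λ w → proj₁ ∘ ∧⁻)
          (λ w (hw , n) → proj₂ (proj₂ (H⁻ {z} {w} hw)) (proj₂ (∧⁻ {R w} n)))
          where
          cases : ∀ w → R w ≡ true → Dec (inc z w ≡ true) → H z w ≡ true ⊎ (R w ∧ inc z w) ≡ true
          cases w wR (yes i) = inj₂ (∧⁺ wR i)
          cases w wR (no ¬i) = inj₁ (∧⁺ (∧⁺ zX wR) (not⁺ ¬i))

-- Intersection-closed families of subsets

∣∣≡# : ∀ {n} (p : Subset n) → ∣ p ∣ ≡ # lookup p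
∣∣≡# [] = refl
∣∣≡# (true ∷ p) = cong suc (∣∣≡# p)
∣∣≡# (false ∷ p) = ∣∣≡# p

∈⁺ : ∀ {n} {p : Subset n} {x} → lookup p x ≡ true → x ∈ p
∈⁺ = lookup⇒[]= _ _

∈⁻ : ∀ {n} {p : Subset n} {x} → x ∈ p → lookup p x ≡ true
∈⁻ = []=⇒lookup

∈⋂⁺ : ∀ {n v} {Bs : List (Subset n)} → All (v ∈_) Bs → v ∈ ⋂ Bs
∈⋂⁺ [] = ∈⊤
∈⋂⁺ (v∈B ∷ rest) = x∈p∩q⁺ (v∈B , ∈⋂⁺ rest)

∈⋂⁻ : ∀ {n v} (Bs : List (Subset n)) → v ∈ ⋂ Bs → All (v ∈_) Bs
∈⋂⁻ [] _ = []
∈⋂⁻ (B ∷ Bs) v∈ = let (v∈B , v∈Bs) = x∈p∩q⁻ B (⋂ Bs) v∈ in v∈B ∷ ∈⋂⁻ Bs v∈Bs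

module IntersectionClosed {r} (𝒞 : Subset r → Bool) (full : 𝒞 ⊤ ≡ true)
  (meet : ∀ A B → 𝒞 A ≡ true → 𝒞 B ≡ true → 𝒞 (A ∩ B) ≡ true) where

  ⋂-closed : ∀ {Bs} → All (λ B → 𝒞 B ≡ true) Bs → 𝒞 (⋂ Bs) ≡ true
  ⋂-closed [] = full
  ⋂-closed (b ∷ bs) = meet _ _ b (⋂-closed bs)

  -- The family 𝒞 is a closure system; X fails to be `Proper` exactly when its closure is
  -- everything, that is, when X is spanning.
  Proper : Subset r → Set
  Proper X = ∃ λ B → 𝒞 B ≡ true × X ⊆ B × ¬ ⊤ ⊆ B

  proper? : ∀ X → Dec (Proper X)
  proper? X = anySubset? (λ B → (𝒞 B 𝔹≟ true) ×-dec (X ⊆? B) ×-dec ¬? (⊤ ⊆? B))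

  -- For x in X, the witness M shows that X without x no longer spans. For x outside X the set `⊤`
  -- qualifies, so that the witnesses form a total function of x.
  Critical : Subset r → Fin r → Set
  Critical X x = ∃ λ M → 𝒞 M ≡ true × X - x ⊆ M × (x ∈ X → x ∉ M)

  -- For minimal spanning X the members of 𝒞 that are intersections of the M x are counted by
  -- the Frankl–Katona theorem, v being incident with x when v ∉ M x.
  minimal-spanning : ∀ {s} X → (∀ x → Critical X x) → r ≤ ∣ X ∣ + s → s < ∣ X ∣ →
                     ∃ λ A → 𝒞 A ≡ true × ∣ A ∣ ≡ s
  minimal-spanning {s} X crit r≤ s<X = build (fk r Xᵇ Rᵇ s (#≤n Xᵇ) R≤s s<#X)
    where
    M : Fin r → Subset r
    M = proj₁ ∘ crit
    Xᵇ = lookup X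
    Rᵇ = not ∘ lookup X
    inc : Fin r → Fin r → Bool
    inc x v = not (lookup (M x) v)
    open FranklKatona inc

    s<#X : s < # Xᵇ
    s<#X = subst (s <_) (∣∣≡# X) s<X

    R≤s : # Rᵇ ≤ s
    R≤s = +-cancelˡ-≤ (# Xᵇ) _ _ (begin
      # Xᵇ + # Rᵇ  ≡⟨ #-⊎ {p = λ _ → true} {Xᵇ} {Rᵇ} (λ x _ → cases (lookup X x)) (λ _ _ → refl)
                        (λ _ _ → refl) (λ x (a , b) → not⁻ b a) ⟨
      # (λ (_ : Fin r) → true)  ≡⟨ #-true {r} (λ _ → refl) ⟩
      r            ≤⟨ r≤ ⟩
      ∣ X ∣ + s    ≡⟨ cong (_+ s) (∣∣≡# X) ⟩
      # Xᵇ + s     ∎)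
      where
      open ≤-Reasoning
      cases : ∀ b → b ≡ true ⊎ not b ≡ true
      cases true = inj₁ refl
      cases false = inj₂ refl

    build : Hits Xᵇ Rᵇ s → ∃ λ A → 𝒞 A ≡ true × ∣ A ∣ ≡ s
    build (W , W⊆X , W#) = A , ⋂-closed (tabulate⁺ N∈𝒞) ,
      trans (∣∣≡# A) (trans (#-⊎ {p = lookup A} {W} {trapped Xᵇ Rᵇ W}
        (λ v → A⇒ v ∘ ∈⁺) (λ v → ∈⁻ ∘ W⇒ v) (λ v → ∈⁻ ∘ trapped⇒ v) disjoint) W#)
      where
      -- Since `⊤` is neutral for intersection, `A` is the intersection of the `M x` with x in X
      -- outside W. Each of these contains all of X except x, so `A` meets X in exactly W. A vertex
      -- outside X lies in `A` when only sets `M x` with x in W can miss it, that is, when it is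
      -- trapped. Hence the size of `A` is the count in `Hits`.
      N : Fin r → Subset r
      N x = if Xᵇ x ∧ not (W x) then M x else ⊤
      A = ⋂ (tabulate N)

      N∈𝒞 : ∀ x → 𝒞 (N x) ≡ true
      N∈𝒞 x with Xᵇ x ∧ not (W x)
      ... | true = proj₁ (proj₂ (crit x))
      ... | false = full

      ∈A⁺ : ∀ v → (∀ x → Xᵇ x ≡ true → ¬ W x ≡ true → v ∈ M x) → v ∈ A
      ∈A⁺ v h = ∈⋂⁺ (tabulate⁺ ∈N)
        where
        ∈N : ∀ x → v ∈ N x
        ∈N x with Xᵇ x ∧ not (W x) in e
        ... | true = let (xX , xW) = ∧⁻ e in h x xX (not⁻ xW)
        ... | false = ∈⊤

      ∈A⁻ : ∀ v → v ∈ A → ∀ x → Xᵇ x ≡ true → ¬ W x ≡ true → v ∈ M x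
      ∈A⁻ v v∈A x xX xW = subst (λ b → v ∈ (if b then M x else ⊤)) (∧⁺ xX (not⁺ xW))
        (tabulate⁻ (∈⋂⁻ (tabulate N) v∈A) x)

      W⇒ : ∀ v → W v ≡ true → v ∈ A
      W⇒ v vW = ∈A⁺ v (λ x xX ¬xW → proj₁ (proj₂ (proj₂ (crit x)))
        (x∈p∧x≢y⇒x∈p-y (∈⁺ (W⊆X v vW)) (λ { refl → ¬xW vW })))

      trapped⇒ : ∀ v → trapped Xᵇ Rᵇ W v ≡ true → v ∈ A
      trapped⇒ v h = ∈A⁺ v λ x xX ¬xW → decidable-stable (v ∈? M x)
        (λ v∉ → ¬xW (proj₂ (trapped⁻ {Xᵇ} {Rᵇ} {W} h) x xX (not⁺ (v∉ ∘ ∈⁺))))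

      A⇒ : ∀ v → v ∈ A → W v ≡ true ⊎ trapped Xᵇ Rᵇ W v ≡ true
      A⇒ v v∈A with W v 𝔹≟ true
      ... | yes vW = inj₁ vW
      ... | no ¬vW = inj₂ (trapped⁺ {Xᵇ} {Rᵇ} {W}
        (not⁺ (λ vX → proj₂ (proj₂ (proj₂ (crit v))) (∈⁺ vX) (∈A⁻ v v∈A v vX ¬vW)))
        (λ x xX xv → decidable-stable (W x 𝔹≟ true)
          (λ ¬xW → not⁻ xv (∈⁻ (∈A⁻ v v∈A x xX ¬xW)))))

      disjoint : ∀ v → ¬ (W v ≡ true × trapped Xᵇ Rᵇ W v ≡ true)
      disjoint v (vW , h) = not⁻ (proj₁ (trapped⁻ {Xᵇ} {Rᵇ} {W} h)) (W⊆X v vW)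

  -- Remove elements from the spanning set `⊤` as long as it stays spanning. If this gets stuck
  -- above size m, the set X reached is minimal spanning, and the two hypotheses on m say precisely
  -- that any X with more than m elements has more than s elements and a complement of at most s.
  -- These are the hypotheses of the Frankl-Katona theorem, and the reason for m = max(s, r - s -
  -- 1).
  member-or-spanning : ∀ {s m} → s ≤ m → r ≤ suc m + s →
    (∃ λ A → 𝒞 A ≡ true × ∣ A ∣ ≡ s) ⊎ (∃ λ X → ∣ X ∣ ≤ m × ¬ Proper X)
  member-or-spanning {s} {m} s≤m r≤ =
    descend r ⊤ (∣p∣≤n ⊤) (λ (_ , _ , ⊤⊆B , ⊤⊈B) → ⊤⊈B ⊤⊆B)
    where
    descend : ∀ k X → ∣ X ∣ ≤ k → ¬ Proper X →
      (∃ λ A → 𝒞 A ≡ true × ∣ A ∣ ≡ s) ⊎ (∃ λ Y → ∣ Y ∣ ≤ m × ¬ Proper Y)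
    descend k X X≤k span with ∣ X ∣ ≤? m
    ... | yes X≤m = inj₂ (X , X≤m , span)
    ... | no X≰m with any? (λ x → (x ∈? X) ×-dec ¬? (proper? (X - x)))
    descend zero X X≤k span | no X≰m | yes (x , x∈X , span-x) =
      contradiction (≤-trans X≤k z≤n) X≰m
    descend (suc k) X X≤k span | no X≰m | yes (x , x∈X , span-x) =
      descend k (X - x) (s≤s⁻¹ (≤-trans (x∈p⇒∣p-x∣<∣p∣ x∈X) X≤k)) span-x
    descend k X X≤k span | no X≰m | no minimal =
      inj₁ (minimal-spanning X critical (≤-trans r≤ (+-monoˡ-≤ s m<X)) (≤-<-trans s≤m m<X))
      where
      m<X = ≰⇒> X≰m

      critical : ∀ x → Critical X x
      critical x with x ∈? X
      ... | no x∉X = ⊤ , full , (λ _ → ∈⊤) , λ x∈X → contradiction x∈X x∉X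
      ... | yes x∈X with proper? (X - x)
      ... | no ¬proper = contradiction (x , x∈X , ¬proper) minimal
      ... | yes (B , B∈𝒞 , X-x⊆B , ⊤⊈B) = B , B∈𝒞 , X-x⊆B ,
            λ _ x∈B → span (B , B∈𝒞 , X⊆B x∈B , ⊤⊈B)
        where
        X⊆B : x ∈ B → X ⊆ B
        X⊆B x∈B {y} y∈X with y ≟ x
        ... | yes refl = x∈B
        ... | no y≢x = X-x⊆B (x∈p∧x≢y⇒x∈p-y y∈X y≢x)

-- Counting in lists

length-filter-mono : ∀ {A : Set} {P Q : A → Set} (P? : Decidable P) (Q? : Decidable Q) →
                     (∀ x → P x → Q x) → ∀ xs → length (filter P? xs) ≤ length (filter Q? xs)
length-filter-mono P? Q? h [] = z≤n
length-filter-mono P? Q? h (x ∷ xs) with P? x | Q? x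
... | yes p | yes q = s≤s (length-filter-mono P? Q? h xs)
... | yes p | no ¬q = contradiction (h x p) ¬q
... | no ¬p | yes q = m≤n⇒m≤1+n (length-filter-mono P? Q? h xs)
... | no ¬p | no ¬q = length-filter-mono P? Q? h xs

length-filter-< : ∀ {A : Set} {P Q : A → Set} (P? : Decidable P) (Q? : Decidable Q) →
                  (∀ x → P x → Q x) → ∀ {a xs} → a ∈ₗ xs → Q a → ¬ P a →
                  length (filter P? xs) < length (filter Q? xs)
length-filter-< P? Q? h {xs = x ∷ xs} (here refl) qa ¬pa with P? x | Q? x
... | yes p | _ = contradiction p ¬pa
... | no _ | yes q = s≤s (length-filter-mono P? Q? h xs)
... | no _ | no ¬q = contradiction qa ¬q
length-filter-< P? Q? h {xs = x ∷ xs} (there a∈) qa ¬pa with P? x | Q? x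
... | yes p | yes q = s≤s (length-filter-< P? Q? h a∈ qa ¬pa)
... | yes p | no ¬q = contradiction (h x p) ¬q
... | no ¬p | yes q = m≤n⇒m≤1+n (length-filter-< P? Q? h a∈ qa ¬pa)
... | no ¬p | no ¬q = length-filter-< P? Q? h a∈ qa ¬pa

length-filter-¬ : ∀ {A : Set} {P : A → Set} (P? : Decidable P) xs →
                  length xs ≡ length (filter P? xs) + length (filter (¬? ∘ P?) xs)
length-filter-¬ P? [] = refl
length-filter-¬ P? (x ∷ xs) with P? x
... | yes _ = cong suc (length-filter-¬ P? xs)
... | no _ = trans (cong suc (length-filter-¬ P? xs)) (sym (+-suc _ _))

-- The classes may overlap: an element is charged to the first class in `cs` that contains it.
length≤classes : ∀ {A C : Set} {P : C → A → Set} (P? : ∀ c → Decidable (P c)) {b} cs F →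
                 (∀ {x} → x ∈ₗ F → ∃ λ c → c ∈ₗ cs × P c x) →
                 (∀ {c} → c ∈ₗ cs → length (filter (P? c) F) ≤ b) →
                 length F ≤ length cs * b
length≤classes P? [] [] cov bd = z≤n
length≤classes P? [] (x ∷ F) cov bd with cov (here refl)
... | _ , () , _
length≤classes {P = P} P? {b} (c ∷ cs) F cov bd = begin
  length F                                ≡⟨ length-filter-¬ (P? c) F ⟩
  length (filter (P? c) F) + length F′    ≤⟨ +-mono-≤ (bd (here refl)) (length≤classes P? cs F′ cov′ bd′) ⟩
  b + length cs * b                       ∎
  where
  open ≤-Reasoning
  F′ = filter (¬? ∘ P? c) F
  cov′ : ∀ {x} → x ∈ₗ F′ → ∃ λ d → d ∈ₗ cs × P d x
  cov′ x∈ with ∈-filter⁻ (¬? ∘ P? c) {xs = F} x∈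
  ... | x∈F , ¬pc with cov x∈F
  ... | d , here refl , pd = contradiction pd ¬pc
  ... | d , there d∈ , pd = d , d∈ , pd
  bd′ : ∀ {d} → d ∈ₗ cs → length (filter (P? d) F′) ≤ b
  bd′ {d} d∈ = ≤-trans (Sublist.length-mono-≤
    (Sublist.filter⁺ (P? d) (P? d) (λ { refl → id }) (Sublist.filter-⊆ (¬? ∘ P? c) F))) (bd (there d∈))

length-cartesianProductWith : ∀ {A B C : Set} (f : A → B → C) xs ys →
  length (cartesianProductWith f xs ys) ≡ length xs * length ys
length-cartesianProductWith f [] ys = refl
length-cartesianProductWith f (x ∷ xs) ys = trans (length-++ (map (f x) ys))
  (cong₂ _+_ (length-map (f x) ys) (length-cartesianProductWith f xs ys))

length-unique-const : ∀ {A : Set} {F : List A} → Unique F →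
                      (∀ {x y} → x ∈ₗ F → y ∈ₗ F → x ≡ y) → length F ≤ 1
length-unique-const {F = []} _ _ = z≤n
length-unique-const {F = x ∷ []} _ _ = ≤-refl
length-unique-const {F = x ∷ y ∷ F} ((x≢y ∷ _) ∷ _) h =
  contradiction (h (here refl) (there (here refl))) x≢y

∈-allSubsets : ∀ {n} (A : Subset n) → A ∈ₗ allSubsets n
∈-allSubsets [] = here refl
∈-allSubsets (true ∷ A) = ∈-++⁺ˡ (∈-map⁺ (true ∷_) (∈-allSubsets A))
∈-allSubsets {suc n} (false ∷ A) = ∈-++⁺ʳ (map (true ∷_) (allSubsets n)) (∈-map⁺ (false ∷_) (∈-allSubsets A))

elements : ∀ {n} (p : Subset n) → Vec (Fin n) ∣ p ∣
elements [] = []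
elements (true ∷ p) = zero ∷ Vec.map suc (elements p)
elements (false ∷ p) = Vec.map suc (elements p)

∈-elements : ∀ {n x} {p : Subset n} → x ∈ p → x ∈ₗ Vec.toList (elements p)
∈-elements {p = true ∷ p} Vec.here = here refl
∈-elements {p = true ∷ p} (Vec.there x∈) =
  there (subst (_ ∈ₗ_) (sym (toList-map suc (elements p))) (∈-map⁺ suc (∈-elements x∈)))
∈-elements {p = false ∷ p} (Vec.there x∈) =
  subst (_ ∈ₗ_) (sym (toList-map suc (elements p))) (∈-map⁺ suc (∈-elements x∈))

-- Families of maps with restricted agreement sets

module Family {M : Set} {n r : ℕ} (at : M → Fin r → Fin n) where

  agreement : M → M → Subset r
  agreement K L = Vec.tabulate (λ i → does (at K i ≟ at L i))

  ∈agreement⁺ : ∀ {K L i} → at K i ≡ at L i → i ∈ agreement K L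
  ∈agreement⁺ {K} {L} {i} e = ∈⁺ (trans (lookup∘tabulate _ i) (dec-true (at K i ≟ at L i) e))

  ∈agreement⁻ : ∀ {K L i} → i ∈ agreement K L → at K i ≡ at L i
  ∈agreement⁻ {K} {L} {i} h = does⁻ (at K i ≟ at L i) (trans (sym (lookup∘tabulate _ i)) (∈⁻ h))

  determined-bound : ∀ (ps : List (Fin r)) F → Unique F →
    (∀ {K L} → K ∈ₗ F → L ∈ₗ F → (∀ {i} → i ∈ₗ ps → at K i ≡ at L i) → K ≡ L) →
    length F ≤ n ^ length ps
  determined-bound [] F uniq det = length-unique-const uniq (λ K∈ L∈ → det K∈ L∈ (λ ()))
  determined-bound (p ∷ ps) F uniq det = subst (λ m → length F ≤ m * n ^ length ps) (length-tabulate (id {A = Fin n}))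
    (length≤classes class? (allFin n) F (λ {K} _ → at K p , ∈-allFin _ , refl)
      (λ {c} _ → determined-bound ps (filter (class? c) F) (filter⁺ (class? c) uniq) (det′ c)))
    where
    class? : ∀ c → Decidable (λ K → at K p ≡ c)
    class? c K = at K p ≟ c
    det′ : ∀ c {K L} → K ∈ₗ filter (class? c) F → L ∈ₗ filter (class? c) F →
           (∀ {i} → i ∈ₗ ps → at K i ≡ at L i) → K ≡ L
    det′ c K∈ L∈ h with ∈-filter⁻ (class? c) {xs = F} K∈ | ∈-filter⁻ (class? c) {xs = F} L∈
    ... | K∈F , Kp | L∈F , Lp = det K∈F L∈F λ { (here refl) → trans Kp (sym Lp) ; (there i∈) → h i∈ }

  rep : Subset r → List M → M → M
  -- Not reached when K is in the list, as K agrees with itself on A.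
  rep A [] K = K
  rep A (L ∷ F) K with A ⊆? agreement L K
  ... | yes _ = L
  ... | no _ = rep A F K

  rep-spec : ∀ A {F K} → K ∈ₗ F → rep A F K ∈ₗ F × A ⊆ agreement (rep A F K) K
  rep-spec A {L ∷ F} {K} K∈ with A ⊆? agreement L K
  ... | yes sub = here refl , sub
  rep-spec A {L ∷ F} {K} (here refl) | no ¬sub =
    ⊥-elim (¬sub (λ _ → ∈agreement⁺ {L} {L} refl))
  rep-spec A {L ∷ F} {K} (there K∈) | no _ = let (a , b) = rep-spec A K∈ in there a , b

  -- The search tests only the restriction to A, which K and K′ share, so it stops at the same entry
  -- for both.
  rep-cong : ∀ A {F K K′} → K ∈ₗ F → A ⊆ agreement K K′ → rep A F K ≡ rep A F K′
  rep-cong A {L ∷ F} {K} {K′} K∈ A⊆ with A ⊆? agreement L K | A ⊆? agreement L K′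
  ... | yes _ | yes _ = refl
  ... | yes s | no ¬s = ⊥-elim (¬s
        (λ i∈ → ∈agreement⁺ {L} {K′} (trans (∈agreement⁻ {L} {K} (s i∈)) (∈agreement⁻ {K} {K′} (A⊆ i∈)))))
  ... | no ¬s | yes s = ⊥-elim (¬s
        (λ i∈ → ∈agreement⁺ {L} {K} (trans (∈agreement⁻ {L} {K′} (s i∈)) (sym (∈agreement⁻ {K} {K′} (A⊆ i∈))))))
  rep-cong A {L ∷ F} (here refl) A⊆ | no ¬s | no _ = ⊥-elim (¬s (λ _ → ∈agreement⁺ {L} {L} refl))
  rep-cong A {L ∷ F} (there K∈) A⊆ | no _ | no _ = rep-cong A K∈ A⊆

  size : (Subset r → Bool) → ℕ
  size 𝒞 = length (filter (λ B → 𝒞 B 𝔹≟ true) (allSubsets r))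

  module _ {s m} (s<r : s < r) (s≤m : s ≤ m) (r≤ : r ≤ suc m + s) (n≥1 : 1 ≤ n) where

    -- Splitting by (i , j), where at K i = at (rep K) j, forces agreement sets containing A to
    -- contain i; so A leaves 𝒞 while 𝒞 stays closed under intersection.
    family-bound : ∀ k (𝒞 : Subset r → Bool) → 𝒞 ⊤ ≡ true →
      (∀ A B → 𝒞 A ≡ true → 𝒞 B ≡ true → 𝒞 (A ∩ B) ≡ true) → size 𝒞 ≤ k →
      ∀ F → Unique F →
      (∀ {K L} → K ∈ₗ F → L ∈ₗ F → 𝒞 (agreement K L) ≡ true) →
      (∀ {K L} → K ∈ₗ F → L ∈ₗ F → ∀ A → ∣ A ∣ ≡ s → A ⊆ agreement K L →
        ∃₂ λ i j → i ∉ A × at L i ≡ at K j) →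
      (∀ {K L} → K ∈ₗ F → L ∈ₗ F → (∀ i → at K i ≡ at L i) → K ≡ L) →
      length F ≤ (r * r) ^ k * n ^ m
    family-bound k 𝒞 full meet size≤ F uniq allowed avoid ext
      with IntersectionClosed.member-or-spanning 𝒞 full meet s≤m r≤
    ... | inj₂ (X , X≤m , spanning) = begin
      length F                       ≤⟨ determined-bound ps F uniq det ⟩
      n ^ length ps                  ≡⟨ cong (n ^_) (length-toList (elements X)) ⟩
      n ^ ∣ X ∣                      ≤⟨ ^-monoʳ-≤ n ⦃ >-nonZero n≥1 ⦄ X≤m ⟩
      n ^ m                          ≤⟨ m≤n*m (n ^ m) ((r * r) ^ k) ⦃ m^n≢0 (r * r) k ⦃ rr≢0 ⦄ ⦄ ⟩
      (r * r) ^ k * n ^ m            ∎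
      where
      open ≤-Reasoning
      rr≢0 = >-nonZero (*-mono-≤ (≤-trans (s≤s z≤n) s<r) (≤-trans (s≤s z≤n) s<r))
      ps = Vec.toList (elements X)
      det : ∀ {K L} → K ∈ₗ F → L ∈ₗ F → (∀ {i} → i ∈ₗ ps → at K i ≡ at L i) → K ≡ L
      -- An agreement set that contains X is a member of 𝒞, so it must be everything, X being
      -- spanning.
      det {K} {L} K∈ L∈ h = ext K∈ L∈ λ i → decidable-stable (at K i ≟ at L i) λ ¬e →
        spanning (agreement K L , allowed K∈ L∈ ,
          (λ x∈ → ∈agreement⁺ {K} {L} (h (∈-elements x∈))) ,
          λ ⊤⊆ → ¬e (∈agreement⁻ {K} {L} (⊤⊆ ∈⊤)))
    family-bound zero 𝒞 full meet size≤ F uniq allowed avoid ext | inj₁ (A , A∈𝒞 , ∣A∣) =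
      contradiction (≤-trans (∈-length (∈-filter⁺ (λ B → 𝒞 B 𝔹≟ true) (∈-allSubsets A) A∈𝒞)) size≤) λ ()
    family-bound (suc k) 𝒞 full meet size≤ F uniq allowed avoid ext | inj₁ (A , A∈𝒞 , ∣A∣) = begin
      length F                                    ≤⟨ length≤classes class? cs F cover bound ⟩
      length cs * ((r * r) ^ k * n ^ m)           ≤⟨ *-monoˡ-≤ _ cs≤ ⟩
      r * r * ((r * r) ^ k * n ^ m)               ≡⟨ *-assoc (r * r) ((r * r) ^ k) (n ^ m) ⟨
      (r * r) ^ suc k * n ^ m                     ∎
      where
      open ≤-Reasoning
      outside? : Decidable (_∉ A)
      outside? i = ¬? (i ∈? A)
      cs = cartesianProduct (filter outside? (allFin r)) (allFin r)

      cs≤ : length cs ≤ r * r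
      cs≤ = begin
        length cs                                   ≡⟨ length-cartesianProductWith _,_ (filter outside? (allFin r)) (allFin r) ⟩
        length (filter outside? (allFin r)) * length (allFin r)
                                                    ≤⟨ *-monoˡ-≤ _ (length-filter outside? (allFin r)) ⟩
        length (allFin r) * length (allFin r)       ≡⟨ cong (λ l → l * l) (length-tabulate (id {A = Fin r})) ⟩
        r * r                                       ∎

      Class : Fin r × Fin r → M → Set
      Class (i , j) K = at K i ≡ at (rep A F K) j
      class? : ∀ c → Decidable (Class c)
      class? (i , j) K = at K i ≟ at (rep A F K) j

      cover : ∀ {K} → K ∈ₗ F → ∃ λ c → c ∈ₗ cs × Class c K
      cover K∈ with rep-spec A K∈
      ... | rep∈ , A⊆ with avoid rep∈ K∈ A ∣A∣ A⊆
      ... | i , j , i∉A , e =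
            (i , j) , ∈-cartesianProduct⁺ (∈-filter⁺ outside? (∈-allFin i) i∉A) (∈-allFin j) , e

      bound : ∀ {c} → c ∈ₗ cs → length (filter (class? c) F) ≤ (r * r) ^ k * n ^ m
      bound {i , j} c∈ = family-bound k 𝒞′ (𝒞′⁺ full (λ _ → ∈⊤)) meet′ size≤′ F′ (filter⁺ (class? (i , j)) uniq)
        allowed′ (λ K∈ L∈ → avoid (F′⊆F K∈) (F′⊆F L∈)) (λ K∈ L∈ → ext (F′⊆F K∈) (F′⊆F L∈))
        where
        F′ = filter (class? (i , j)) F
        i∉A : i ∉ A
        i∉A = proj₂ (∈-filter⁻ outside? {xs = allFin r}
                (proj₁ (∈-cartesianProduct⁻ (filter outside? (allFin r)) (allFin r) c∈)))

        forces? : ∀ B → Dec (A ⊆ B → i ∈ B)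
        forces? B = A ⊆? B →-dec i ∈? B
        𝒞′ : Subset r → Bool
        𝒞′ B = 𝒞 B ∧ does (forces? B)
        𝒞′⁺ : ∀ {B} → 𝒞 B ≡ true → (A ⊆ B → i ∈ B) → 𝒞′ B ≡ true
        𝒞′⁺ {B} B∈ h = ∧⁺ B∈ (dec-true (forces? B) h)
        𝒞′⁻ : ∀ {B} → 𝒞′ B ≡ true → 𝒞 B ≡ true × (A ⊆ B → i ∈ B)
        𝒞′⁻ {B} h = let (B∈ , f) = ∧⁻ {𝒞 B} h in B∈ , does⁻ (forces? B) f

        meet′ : ∀ B B′ → 𝒞′ B ≡ true → 𝒞′ B′ ≡ true → 𝒞′ (B ∩ B′) ≡ true
        meet′ B B′ h h′ with 𝒞′⁻ {B} h | 𝒞′⁻ {B′} h′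
        ... | B∈ , f | B′∈ , f′ = 𝒞′⁺ (meet B B′ B∈ B′∈) λ A⊆ →
              x∈p∩q⁺ (f (p∩q⊆p B B′ ∘ A⊆) , f′ (p∩q⊆q B B′ ∘ A⊆))

        size≤′ : size 𝒞′ ≤ k
        size≤′ = s≤s⁻¹ (≤-trans (length-filter-< (λ B → 𝒞′ B 𝔹≟ true) (λ B → 𝒞 B 𝔹≟ true)
          (λ B → proj₁ ∘ 𝒞′⁻ {B}) (∈-allSubsets A) A∈𝒞 (λ h → i∉A (proj₂ (𝒞′⁻ {A} h) id))) size≤)

        F′⊆F : ∀ {K} → K ∈ₗ F′ → K ∈ₗ F
        F′⊆F = proj₁ ∘ ∈-filter⁻ (class? (i , j)) {xs = F}

        allowed′ : ∀ {K L} → K ∈ₗ F′ → L ∈ₗ F′ → 𝒞′ (agreement K L) ≡ true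
        allowed′ {K} {L} K∈ L∈ with ∈-filter⁻ (class? (i , j)) {xs = F} K∈ | ∈-filter⁻ (class? (i , j)) {xs = F} L∈
        ... | K∈F , Ki | L∈F , Li = 𝒞′⁺ (allowed K∈F L∈F) λ A⊆ → ∈agreement⁺ {K} {L}
              (trans Ki (trans (cong (λ x → at x j) (rep-cong A K∈F A⊆)) (sym Li)))

-- Enumerating subsets and their elements

Unique-allSubsets : ∀ n → Unique (allSubsets n)
Unique-allSubsets zero = [] ∷ []
Unique-allSubsets (suc n) = ++⁺ (map⁺ ∷-injectiveʳ (Unique-allSubsets n)) (map⁺ ∷-injectiveʳ (Unique-allSubsets n))
  λ (a , b) → disjoint (∈-map⁻ (true ∷_) a) (∈-map⁻ (false ∷_) b)
  where
  disjoint : ∀ {v : Subset (suc n)} → (∃ λ x → x ∈ₗ allSubsets n × v ≡ true ∷ x) →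
             ¬ (∃ λ x → x ∈ₗ allSubsets n × v ≡ false ∷ x)
  disjoint (_ , _ , refl) (_ , _ , ())

elements-∈ : ∀ {n} (p : Subset n) i → lookup (elements p) i ∈ p
elements-∈ (true ∷ p) zero = Vec.here
elements-∈ (true ∷ p) (suc i) =
  subst (_∈ true ∷ p) (sym (lookup-map i suc (elements p))) (Vec.there (elements-∈ p i))
elements-∈ (false ∷ p) i =
  subst (_∈ false ∷ p) (sym (lookup-map i suc (elements p))) (Vec.there (elements-∈ p i))

elements-injective : ∀ {n} (p : Subset n) {i j} → lookup (elements p) i ≡ lookup (elements p) j → i ≡ j
elements-injective (true ∷ p) {zero} {zero} e = refl
elements-injective (true ∷ p) {zero} {suc j} e with () ← trans e (lookup-map j suc (elements p))
elements-injective (true ∷ p) {suc i} {zero} e with () ← trans (sym e) (lookup-map i suc (elements p))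
elements-injective (true ∷ p) {suc i} {suc j} e = cong suc (elements-injective p (suc-injective
  (trans (sym (lookup-map i suc (elements p))) (trans e (lookup-map j suc (elements p))))))
elements-injective (false ∷ p) {i} {j} e = elements-injective p (suc-injective
  (trans (sym (lookup-map i suc (elements p))) (trans e (lookup-map j suc (elements p)))))

elements-surjective : ∀ {n} {p : Subset n} {x} → x ∈ p → ∃ λ i → lookup (elements p) i ≡ x
elements-surjective {p = true ∷ p} Vec.here = zero , refl
elements-surjective {p = true ∷ p} (Vec.there x∈) with elements-surjective x∈
... | i , e = suc i , trans (lookup-map i suc (elements p)) (cong suc e)
elements-surjective {p = false ∷ p} (Vec.there x∈) with elements-surjective x∈
... | i , e = i , trans (lookup-map i suc (elements p)) (cong suc e)

-- Cliques

and⁻ : ∀ {A : Set} {f : A → Bool} {xs x} → and (map f xs) ≡ true → x ∈ₗ xs → f x ≡ true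
and⁻ h (here refl) = proj₁ (∧⁻ h)
and⁻ {f = f} {y ∷ _} h (there x∈) = and⁻ (proj₂ (∧⁻ {f y} h)) x∈

and⁺ : ∀ {A : Set} {f : A → Bool} xs → (∀ x → f x ≡ true) → and (map f xs) ≡ true
and⁺ [] h = refl
and⁺ (x ∷ xs) h = ∧⁺ (h x) (and⁺ xs h)

Clique : ∀ {n} → Graph n → Subset n → Set
Clique G S = ∀ {x y} → x ∈ S → y ∈ S → x ≢ y → adj G x y ≡ true

isClique⁻ : ∀ {n} (G : Graph n) {S} → isCliqueᵇ G S ≡ true → Clique G S
isClique⁻ {n} G {S} h {x} {y} x∈ y∈ x≢y = lemma (and⁻ (and⁻ h (∈-allFin x)) (∈-allFin y))
  where
  lemma : not (lookup S x ∧ lookup S y) ∨ ⌊ x ≟ y ⌋ ∨ adj G x y ≡ true → adj G x y ≡ true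
  lemma e rewrite ∈⁻ x∈ | ∈⁻ y∈ with x ≟ y
  ... | yes x≡y = contradiction x≡y x≢y
  ... | no _ = e

isClique⁺ : ∀ {n} (G : Graph n) {S} → Clique G S → isCliqueᵇ G S ≡ true
isClique⁺ {n} G {S} h = and⁺ (allFin n) λ x → and⁺ (allFin n) (lemma x)
  where
  lemma : ∀ x y → not (lookup S x ∧ lookup S y) ∨ ⌊ x ≟ y ⌋ ∨ adj G x y ≡ true
  lemma x y with lookup S x in xS | lookup S y in yS | x ≟ y
  ... | false | _ | _ = refl
  ... | true | false | _ = refl
  ... | true | true | yes _ = refl
  ... | true | true | no x≢y = h (∈⁺ xS) (∈⁺ yS) x≢y

IsKr : ∀ (r : ℕ) {n} → Graph n → Subset n → Bool
IsKr r G S = ⌊ ∣ S ∣ ℕ.≟ r ⌋ ∧ isCliqueᵇ G S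

cliques : ∀ (r : ℕ) {n} → Graph n → List (Subset n)
cliques r {n} G = filterᵇ (IsKr r G) (allSubsets n)

∈cliques⁻ : ∀ {r n} (G : Graph n) {S} → S ∈ₗ cliques r G → ∣ S ∣ ≡ r × Clique G S
∈cliques⁻ {r} {n} G {S} S∈
  with ∧⁻ {⌊ ∣ S ∣ ℕ.≟ r ⌋} (Equivalence.to T-≡ (proj₂ (∈-filter⁻ _ {xs = allSubsets n} S∈)))
... | size , clique = does⁻ (∣ S ∣ ℕ.≟ r) (trans (sym (isYes≗does (∣ S ∣ ℕ.≟ r))) size) , isClique⁻ G clique

∈cliques⁺ : ∀ {r n} (G : Graph n) {S} → ∣ S ∣ ≡ r → Clique G S → S ∈ₗ cliques r G
∈cliques⁺ {r} {n} G {S} size clique = ∈-filter⁺ _ (∈-allSubsets S) (Equivalence.from T-≡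
  (∧⁺ (trans (isYes≗does (∣ S ∣ ℕ.≟ r)) (dec-true (∣ S ∣ ℕ.≟ r) size)) (isClique⁺ G clique)))

-- Two cliques that span B_{r,s}, and the upper bound

∨⁻ : ∀ {a b} → a ∨ b ≡ true → a ≡ true ⊎ b ≡ true
∨⁻ {true} _ = inj₁ refl
∨⁻ {false} h = inj₂ h

B-adj⁻ : ∀ r s {i j} → B-adj r s i j ≡ true →
         i ≢ j × ((toℕ i < r × toℕ j < r) ⊎ (r ∸ s ≤ toℕ i × r ∸ s ≤ toℕ j))
B-adj⁻ r s {i} {j} h with i ≟ j
... | no i≢j = i≢j , split (∨⁻ h)
  where
  split : _ → _
  split (inj₁ e) = let (a , b) = ∧⁻ {toℕ i <ᵇ r} e in
    inj₁ (<ᵇ⇒< _ _ (Equivalence.from T-≡ a) , <ᵇ⇒< _ _ (Equivalence.from T-≡ b))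
  split (inj₂ e) = let (a , b) = ∧⁻ {r ∸ s ≤ᵇ toℕ i} e in
    inj₂ (≤ᵇ⇒≤ _ _ (Equivalence.from T-≡ a) , ≤ᵇ⇒≤ _ _ (Equivalence.from T-≡ b))

module _ {n r} (G : Graph n) {S S′ : Subset n} (S-clique : Clique G S) (S′-clique : Clique G S′)
  {K L : Fin r → Fin n} (K∈S : ∀ i → K i ∈ S) (L∈S′ : ∀ i → L i ∈ S′)
  (K-inj : ∀ {i j} → K i ≡ K j → i ≡ j) (L-inj : ∀ {i j} → L i ≡ L j → i ≡ j)
  (A : Subset r) (agree : ∀ {i} → i ∈ A → K i ≡ L i)
  (avoid : ∀ {i j} → i ∉ A → L i ≢ K j) where

  private
    s = ∣ A ∣
    d = ∣ ∁ A ∣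
    Part = Fin d ⊎ (Fin s ⊎ Fin d)

    d≡ : d ≡ r ∸ s
    d≡ = ∣∁p∣≡n∸∣p∣ A

    d+s≡r : d + s ≡ r
    d+s≡r = trans (cong (_+ s) d≡) (m∸n+n≡m (∣p∣≤n A))

    N≡ : (r + r) ∸ s ≡ d + (s + d)
    N≡ = begin
      (r + r) ∸ s              ≡⟨ cong (λ x → (x + x) ∸ s) (sym d+s≡r) ⟩
      ((d + s) + (d + s)) ∸ s  ≡⟨ cong (_∸ s) (sym (+-assoc (d + s) d s)) ⟩
      ((d + s) + d + s) ∸ s    ≡⟨ m+n∸n≡m (d + s + d) s ⟩
      (d + s) + d              ≡⟨ +-assoc d s d ⟩
      d + (s + d)              ∎
      where open ≡-Reasoning

    position : Part → ℕ
    position (inj₁ i) = toℕ i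
    position (inj₂ (inj₁ j)) = d + toℕ j
    position (inj₂ (inj₂ k)) = d + (s + toℕ k)

    part : Fin ((r + r) ∸ s) → Part
    part v = map₂ (splitAt s) (splitAt d (cast N≡ v))

    position-part : ∀ v → position (part v) ≡ toℕ v
    position-part v with splitAt d (cast N≡ v) in e
    ... | inj₁ i = trans (sym (toℕ-↑ˡ i (s + d))) (trans (cong toℕ (splitAt⁻¹-↑ˡ e)) (toℕ-cast N≡ v))
    ... | inj₂ w with splitAt s w in e′
    ... | inj₁ j = trans (cong (d +_) (trans (sym (toℕ-↑ˡ j d)) (cong toℕ (splitAt⁻¹-↑ˡ e′))))
                     (trans (sym (toℕ-↑ʳ d w)) (trans (cong toℕ (splitAt⁻¹-↑ʳ {d} e)) (toℕ-cast N≡ v)))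
    ... | inj₂ k = trans (cong (d +_) (trans (sym (toℕ-↑ʳ s k)) (cong toℕ (splitAt⁻¹-↑ʳ {s} e′))))
                     (trans (sym (toℕ-↑ʳ d w)) (trans (cong toℕ (splitAt⁻¹-↑ʳ {d} e)) (toℕ-cast N≡ v)))

    out : Fin d → Fin r
    out = lookup (elements (∁ A))
    out∉ : ∀ i → out i ∉ A
    out∉ i = x∈∁p⇒x∉p (elements-∈ (∁ A) i)
    inn : Fin s → Fin r
    inn = lookup (elements A)
    inn∈ : ∀ i → inn i ∈ A
    inn∈ = elements-∈ A

    -- The private part of S, then the common part, then the private part of S′: the vertex order of B-adj.
    vertex : Part → Fin n
    vertex (inj₁ i) = K (out i)
    vertex (inj₂ (inj₁ j)) = K (inn j)
    vertex (inj₂ (inj₂ k)) = L (out k)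

    vertex-injective : ∀ u w → vertex u ≡ vertex w → u ≡ w
    vertex-injective (inj₁ i) (inj₁ i′) e = cong inj₁ (elements-injective (∁ A) (K-inj e))
    vertex-injective (inj₁ i) (inj₂ (inj₁ j)) e =
      contradiction (subst (_∈ A) (sym (K-inj e)) (inn∈ j)) (out∉ i)
    vertex-injective (inj₁ i) (inj₂ (inj₂ k)) e = contradiction (sym e) (avoid (out∉ k))
    vertex-injective (inj₂ (inj₁ j)) (inj₁ i) e =
      contradiction (subst (_∈ A) (K-inj e) (inn∈ j)) (out∉ i)
    vertex-injective (inj₂ (inj₁ j)) (inj₂ (inj₁ j′)) e =
      cong (inj₂ ∘ inj₁) (elements-injective A (K-inj e))
    vertex-injective (inj₂ (inj₁ j)) (inj₂ (inj₂ k)) e = contradiction (sym e) (avoid (out∉ k))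
    vertex-injective (inj₂ (inj₂ k)) (inj₁ i) e = contradiction e (avoid (out∉ k))
    vertex-injective (inj₂ (inj₂ k)) (inj₂ (inj₁ j)) e = contradiction e (avoid (out∉ k))
    vertex-injective (inj₂ (inj₂ k)) (inj₂ (inj₂ k′)) e =
      cong (inj₂ ∘ inj₂) (elements-injective (∁ A) (L-inj e))

    vertex∈S : ∀ u → position u < r → vertex u ∈ S
    vertex∈S (inj₁ i) _ = K∈S _
    vertex∈S (inj₂ (inj₁ j)) _ = K∈S _
    vertex∈S (inj₂ (inj₂ k)) lt = contradiction lt (≤⇒≯ (≤-trans (≤-reflexive (sym d+s≡r))
      (+-monoʳ-≤ d (m≤m+n s (toℕ k)))))

    vertex∈S′ : ∀ u → r ∸ s ≤ position u → vertex u ∈ S′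
    vertex∈S′ (inj₁ i) le = contradiction (≤-trans (≤-reflexive d≡) le) (<⇒≱ (toℕ<n i))
    vertex∈S′ (inj₂ (inj₁ j)) _ = subst (_∈ S′) (sym (agree (inn∈ j))) (L∈S′ _)
    vertex∈S′ (inj₂ (inj₂ k)) _ = L∈S′ _

  -- The one-sided condition `avoid` already makes S and S′ meet only in the vertices indexed by A:
  -- it keeps the private vertices of L away from all of K, and every other vertex of L is a vertex
  -- of K with an index in A.
  cliques-span-B : ContainsCopy (B-adj r ∣ A ∣) G
  cliques-span-B = vertex ∘ part , injective , edge
    where
    injective : ∀ {v w} → vertex (part v) ≡ vertex (part w) → v ≡ w
    injective {v} {w} e = toℕ-injective (trans (sym (position-part v))
      (trans (cong position (vertex-injective (part v) (part w) e)) (position-part w)))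

    edge : ∀ v w → B-adj r s v w ≡ true → adj G (vertex (part v)) (vertex (part w)) ≡ true
    edge v w h with B-adj⁻ r s {v} {w} h
    ... | v≢w , inj₁ (v< , w<) = S-clique
          (vertex∈S (part v) (subst (_< r) (sym (position-part v)) v<))
          (vertex∈S (part w) (subst (_< r) (sym (position-part w)) w<)) (v≢w ∘ injective)
    ... | v≢w , inj₂ (≤v , ≤w) = S′-clique
          (vertex∈S′ (part v) (subst (r ∸ s ≤_) (sym (position-part v)) ≤v))
          (vertex∈S′ (part w) (subst (r ∸ s ≤_) (sym (position-part w)) ≤w)) (v≢w ∘ injective)

-- Junk if ∣ S ∣ ≢ r.
enumerate : ∀ {n} r → Subset (suc n) → Fin r → Fin (suc n)
enumerate r S i with ∣ S ∣ ℕ.≟ r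
... | yes refl = lookup (elements S) i
... | no _ = zero

enumerate-spec : ∀ {n r} (S : Subset (suc n)) → ∣ S ∣ ≡ r →
  (∀ i → enumerate r S i ∈ S) × (∀ {i j} → enumerate r S i ≡ enumerate r S j → i ≡ j) ×
  (∀ {x} → x ∈ S → ∃ λ i → enumerate r S i ≡ x)
enumerate-spec {r = r} S size with ∣ S ∣ ℕ.≟ r
... | yes refl = elements-∈ S , elements-injective S , elements-surjective
... | no ¬size = contradiction size ¬size

-- B-freeness enters only through `avoid`: two copies agreeing on an s-set A without a further
-- coincidence would satisfy `cliques-span-B`. The vertex count is a successor because `enumerate`
-- needs a default vertex.
upper : ∀ {r s m} → s < r → s ≤ m → r ≤ suc m + s →
        ∃ λ C → ∀ n → ExUpper r s (suc n) m C
upper {r} {s} {m} s<r s≤m r≤ = C , bound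
  where
  -- The exponent is 2^r, the size of the family of all subsets. It is written as `size` unfolds, so
  -- that `≤-refl` bounds the number of rounds, and outside the module `Family`, so that it visibly
  -- does not depend on n.
  C = (r * r) ^ length (filter (λ B → true 𝔹≟ true) (allSubsets r))
  bound : ∀ n → ExUpper r s (suc n) m C
  bound n G free = family-bound s<r s≤m r≤ (s≤s z≤n) _ (λ _ → true) refl (λ _ _ _ _ → refl) ≤-refl
    (cliques r G) (filter⁺ _ (Unique-allSubsets (suc n))) (λ _ _ → refl) avoid ext
    where
    open Family (enumerate {n} r)
    avoid : ∀ {K L} → K ∈ₗ cliques r G → L ∈ₗ cliques r G → ∀ A → ∣ A ∣ ≡ s → A ⊆ agreement K L →
            ∃₂ λ i j → i ∉ A × enumerate r L i ≡ enumerate r K j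
    avoid {K} {L} K∈ L∈ A refl A⊆
      with any? (λ i → any? (λ j → ¬? (i ∈? A) ×-dec (enumerate r L i ≟ enumerate r K j)))
    ... | yes found = found
    ... | no none =
      let (K-size , K-clique) = ∈cliques⁻ G K∈ ; (K∈S , K-inj , _) = enumerate-spec K K-size
          (L-size , L-clique) = ∈cliques⁻ G L∈ ; (L∈S , L-inj , _) = enumerate-spec L L-size
      in contradiction (cliques-span-B G K-clique L-clique K∈S L∈S K-inj L-inj A
           (λ i∈ → ∈agreement⁻ {K} {L} (A⊆ i∈)) (λ {i} {j} i∉ e → none (i , j , i∉ , e))) free

    sub : ∀ {K L} → ∣ K ∣ ≡ r → ∣ L ∣ ≡ r → (∀ i → enumerate r K i ≡ enumerate r L i) → K ⊆ L
    sub {K} {L} K-size L-size h x∈ =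
      let (_ , _ , surj) = enumerate-spec K K-size ; (L∈ , _) = enumerate-spec L L-size ; (i , e) = surj x∈
      in subst (_∈ L) (trans (sym (h i)) e) (L∈ i)

    ext : ∀ {K L} → K ∈ₗ cliques r G → L ∈ₗ cliques r G →
          (∀ i → enumerate r K i ≡ enumerate r L i) → K ≡ L
    ext K∈ L∈ h = let (K-size , _) = ∈cliques⁻ G K∈ ; (L-size , _) = ∈cliques⁻ G L∈ in
      ⊆-antisym (sub K-size L-size h) (sub L-size K-size (sym ∘ h))

-- Joins of disjoint unions of cliques

injective⇒surjective : ∀ {n} (σ : Fin n → Fin n) → (∀ {i j} → σ i ≡ σ j → i ≡ j) →
                       ∀ p → ∃ λ i → σ i ≡ p
injective⇒surjective {suc n} σ inj p with any? (λ i → σ i ≟ p)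
... | yes found = found
... | no none = contradiction (injective⇒≤ {f = λ i → punchOut (miss i)}
        (λ e → inj (punchOut-injective (miss _) (miss _) e))) (<-irrefl refl)
  where
  miss : ∀ i → p ≢ σ i
  miss i e = none (i , sym e)

#-reindex : ∀ {n} (p : Fin n → Bool) (σ : Fin n → Fin n) → (∀ {i j} → σ i ≡ σ j → i ≡ j) →
            # (p ∘ σ) ≡ # p
#-reindex p σ inj = sym (sum-permute (⟦_⟧ ∘ p) (permutation σ τ
  (λ p → proj₂ (surj p)) (λ i → inj (proj₂ (surj (σ i))))))
  where
  surj = injective⇒surjective σ inj
  τ = proj₁ ∘ surj

#-≥ : ∀ d r → # (λ (j : Fin r) → does (d ≤? toℕ j)) ≡ r ∸ d
#-≥ zero r = #-true {r} (λ _ → refl)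
#-≥ (suc d) zero = refl
#-≥ (suc d) (suc r) = trans (sum-cong-≗ {r} (λ j → ⟦⟧-cong
  (λ e → dec-true (d ≤? toℕ j) (s≤s⁻¹ (does⁻ (suc d ≤? suc (toℕ j)) e)))
  (λ e → dec-true (suc d ≤? suc (toℕ j)) (s≤s (does⁻ (d ≤? toℕ j) e))))) (#-≥ d r)

#-+ : ∀ m {n} (p : Fin (m + n) → Bool) → # p ≡ # (λ i → p (i ↑ˡ n)) + # (λ j → p (m ↑ʳ j))
#-+ zero p = refl
#-+ (suc m) {n} p = trans (cong (⟦ p zero ⟧ +_) (#-+ m (p ∘ suc))) (sym (+-assoc ⟦ p zero ⟧ _ _))

Bool-ext : ∀ {a b} → (a ≡ true → b ≡ true) → (b ≡ true → a ≡ true) → a ≡ b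
Bool-ext {true} f g = sym (f refl)
Bool-ext {false} {true} f g = g refl
Bool-ext {false} {false} f g = refl

B-adj⁺ : ∀ r s {i j} → i ≢ j → (toℕ i < r × toℕ j < r) ⊎ (r ∸ s ≤ toℕ i × r ∸ s ≤ toℕ j) →
         B-adj r s i j ≡ true
B-adj⁺ r s {i} {j} i≢j h with i ≟ j
... | yes i≡j = contradiction i≡j i≢j
... | no _ with h
... | inj₂ (a , b) rewrite Equivalence.to T-≡ (≤⇒≤ᵇ a) | Equivalence.to T-≡ (≤⇒≤ᵇ b) =
  ∨-zeroʳ ((toℕ i <ᵇ r) ∧ (toℕ j <ᵇ r))
... | inj₁ (a , b) rewrite Equivalence.to T-≡ (<⇒<ᵇ a) | Equivalence.to T-≡ (<⇒<ᵇ b) = refl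

choices : ∀ {t} → (Fin t → ℕ) → List (Vec ℕ t)
choices {zero} mult = [] ∷ []
choices {suc t} mult = cartesianProductWith _∷_ (upTo (mult zero)) (choices (mult ∘ suc))

Unique-choices : ∀ {t} (mult : Fin t → ℕ) → Unique (choices mult)
Unique-choices {zero} mult = [] ∷ []
Unique-choices {suc t} mult =
  cartesianProductWith⁺ _∷_ ∷-injective (upTo⁺ (mult zero)) (Unique-choices (mult ∘ suc))

choices-< : ∀ {t} (mult : Fin t → ℕ) {c} → c ∈ₗ choices mult → ∀ i → lookup c i < mult i
choices-< {suc t} mult c∈ i
  with ∈-cartesianProductWith⁻ _∷_ (upTo (mult zero)) (choices (mult ∘ suc)) c∈
choices-< {suc t} mult c∈ zero | a , c , a∈ , c∈′ , refl = ∈-upTo⁻ a∈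
choices-< {suc t} mult c∈ (suc i) | a , c , a∈ , c∈′ , refl = choices-< (mult ∘ suc) c∈′ i

length-choices : ∀ {t} (mult : Fin (suc t) → ℕ) →
                 length (choices mult) ≡ mult zero * length (choices (mult ∘ suc))
length-choices mult = trans (length-cartesianProductWith _∷_ (upTo (mult zero)) _)
  (cong (_* length (choices (mult ∘ suc))) (length-upTo (mult zero)))

length-choices-const : ∀ t q → length (choices {t} (λ _ → q)) ≡ q ^ t
length-choices-const zero q = refl
length-choices-const (suc t) q = trans (length-choices {t} (λ _ → q)) (cong (q *_) (length-choices-const t q))

-- A vertex x is copy number `copy x` of position `pos x` of K_r; the positions are grouped into
-- blocks, and block b comes in mult b disjoint copies, any two distinct blocks being fully joined.
module BlockGraph {n r t} (block : Fin r → Fin t) (mult : Fin t → ℕ)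
  (pos : Fin n → Fin r) (copy : Fin n → ℕ)
  (determine : ∀ {x y} → pos x ≡ pos y → copy x ≡ copy y → x ≡ y)
  (realise : ∀ p c → c < mult (block p) → ∃ λ x → pos x ≡ p × copy x ≡ c)
  (block-surjective : ∀ b → ∃ λ p → block p ≡ b) where

  blk : Fin n → Fin t
  blk = block ∘ pos

  -- The first two conditions isolate every vertex whose copy number is not below the multiplicity
  -- of its block. This disposes of the vertices left over when r does not divide n, and of the
  -- surplus copies of a block used fewer times than others.
  Adj : Fin n → Fin n → Set
  Adj x y = copy x < mult (blk x) × copy y < mult (blk y) × x ≢ y × (blk x ≡ blk y → copy x ≡ copy y)

  adj? : ∀ x y → Dec (Adj x y)
  adj? x y = (copy x <? mult (blk x)) ×-dec (copy y <? mult (blk y)) ×-dec ¬? (x ≟ y) ×-dec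
             (blk x ≟ blk y →-dec copy x ℕ.≟ copy y)

  Adj-sym : ∀ {x y} → Adj x y → Adj y x
  Adj-sym (a , b , x≢y , same) = b , a , x≢y ∘ sym , sym ∘ same ∘ sym

  graph : Graph n
  graph = record
    { adj = λ x y → does (adj? x y)
    ; sym = λ x y → Bool-ext (dec-true (adj? y x) ∘ Adj-sym ∘ does⁻ (adj? x y))
                             (dec-true (adj? x y) ∘ Adj-sym ∘ does⁻ (adj? y x))
    ; irrefl = λ x → dec-false (adj? x x) (λ (_ , _ , x≢x , _) → x≢x refl)
    }

  module KrCopy (r≥2 : 2 ≤ r) (h : Fin r → Fin n) (edge : ∀ {i j} → i ≢ j → Adj (h i) (h j)) where

    same-copy : ∀ {i j} → blk (h i) ≡ blk (h j) → copy (h i) ≡ copy (h j)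
    same-copy {i} {j} e with i ≟ j
    ... | yes refl = refl
    ... | no i≢j = proj₂ (proj₂ (proj₂ (edge i≢j))) e

    alive : ∀ i → copy (h i) < mult (blk (h i))
    alive i with ∃≢ r≥2 i
      where
      ∃≢ : ∀ {r} → 2 ≤ r → (i : Fin r) → ∃ λ j → i ≢ j
      ∃≢ (s≤s (s≤s _)) zero = suc zero , λ ()
      ∃≢ (s≤s (s≤s _)) (suc i) = zero , λ ()
    ... | j , i≢j = proj₁ (edge i≢j)

    -- Equal positions lie in one block, where adjacency forces equal copy numbers, and position and
    -- copy number determine a vertex. So a K_r uses each position once and consists of one full
    -- copy of each block.
    pos-injective : ∀ {i j} → pos (h i) ≡ pos (h j) → i ≡ j
    pos-injective {i} {j} e = decidable-stable (i ≟ j) λ i≢j →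
      proj₁ (proj₂ (proj₂ (edge i≢j))) (determine e (same-copy (cong block e)))

    pos-surjective : ∀ p → ∃ λ i → pos (h i) ≡ p
    pos-surjective = injective⇒surjective (pos ∘ h) pos-injective

  -- Two copies of K_r in this graph share, block by block, all or nothing, so the number of common
  -- vertices is the total size of a set g of blocks. A block with only one available copy always
  -- belongs to g.
  block-B-free : ∀ {s} → 2 ≤ r → s < r →
    (∀ (g : Fin t → Bool) → (∀ b → mult b ≤ 1 → g b ≡ true) → # (g ∘ block) ≢ s) →
    B-free r s graph
  block-B-free {s} r≥2 s<r avoid (f , f-inj , f-edge) = avoid g pinned (begin
    # (g ∘ block)                                   ≡⟨ #-reindex (g ∘ block) (pos ∘ h₁) H₁.pos-injective ⟨
    # (g ∘ blk ∘ h₁)                                ≡⟨ #-cong {p = g ∘ blk ∘ h₁} {λ j → does (d ≤? toℕ j)} g⇒≥ ≥⇒g ⟩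
    # (λ (j : Fin r) → does (d ≤? toℕ j))           ≡⟨ #-≥ d r ⟩
    r ∸ (r ∸ s)                                     ≡⟨ m∸[m∸n]≡n (<⇒≤ s<r) ⟩
    s                                               ∎)
    where
    open ≡-Reasoning
    d = r ∸ s
    N≡ : (r + r) ∸ s ≡ r + d
    N≡ = +-∸-assoc r (<⇒≤ s<r)

    e₁< : ∀ (j : Fin r) → toℕ j < (r + r) ∸ s
    e₁< j = ≤-trans (toℕ<n j) (≤-trans (m≤m+n r d) (≤-reflexive (sym N≡)))
    e₂< : ∀ (j : Fin r) → toℕ j + d < (r + r) ∸ s
    e₂< j = ≤-trans (+-monoˡ-≤ d (toℕ<n j)) (≤-reflexive (sym N≡))
    -- The two K_r of B_{r,s} in its vertex order. Vertex j of the first is common to both exactly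
    -- when j ≥ d, and it is then vertex j - d of the second.
    e₁ e₂ : Fin r → Fin ((r + r) ∸ s)
    e₁ j = fromℕ< (e₁< j)
    e₂ j = fromℕ< (e₂< j)
    toℕ-e₁ : ∀ j → toℕ (e₁ j) ≡ toℕ j
    toℕ-e₁ j = toℕ-fromℕ< (e₁< j)
    toℕ-e₂ : ∀ j → toℕ (e₂ j) ≡ toℕ j + d
    toℕ-e₂ j = toℕ-fromℕ< (e₂< j)
    h₁ h₂ : Fin r → Fin n
    h₁ = f ∘ e₁
    h₂ = f ∘ e₂

    edge : ∀ {v w} → B-adj r s v w ≡ true → Adj (f v) (f w)
    edge {v} {w} e = does⁻ (adj? (f v) (f w)) (f-edge v w e)

    edge₁ : ∀ {i j} → i ≢ j → Adj (h₁ i) (h₁ j)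
    edge₁ {i} {j} i≢j = edge (B-adj⁺ r s
      (λ e → i≢j (toℕ-injective (trans (sym (toℕ-e₁ i)) (trans (cong toℕ e) (toℕ-e₁ j)))))
      (inj₁ (subst (_< r) (sym (toℕ-e₁ i)) (toℕ<n i) , subst (_< r) (sym (toℕ-e₁ j)) (toℕ<n j))))

    edge₂ : ∀ {i j} → i ≢ j → Adj (h₂ i) (h₂ j)
    edge₂ {i} {j} i≢j = edge (B-adj⁺ r s
      (λ e → i≢j (toℕ-injective (+-cancelʳ-≡ d _ _
        (trans (sym (toℕ-e₂ i)) (trans (cong toℕ e) (toℕ-e₂ j))))))
      (inj₂ (subst (d ≤_) (sym (toℕ-e₂ i)) (m≤n+m d _) , subst (d ≤_) (sym (toℕ-e₂ j)) (m≤n+m d _))))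

    module H₁ = KrCopy r≥2 h₁ edge₁
    module H₂ = KrCopy r≥2 h₂ edge₂

    Shared : Fin t → Set
    Shared b = ∃ λ j → blk (h₁ j) ≡ b × ∃ λ k → h₁ j ≡ h₂ k
    shared? : ∀ b → Dec (Shared b)
    shared? b = any? (λ j → (blk (h₁ j) ≟ b) ×-dec any? (λ k → h₁ j ≟ h₂ k))
    g : Fin t → Bool
    g = does ∘ shared?

    -- One common vertex makes the whole block common, since inside each K_r the vertices of a block
    -- carry the same copy number.
    shared⇒ : ∀ j → Shared (blk (h₁ j)) → ∃ λ k → h₁ j ≡ h₂ k
    shared⇒ j (j′ , b≡ , k′ , e) with H₂.pos-surjective (pos (h₁ j))
    ... | k , pos≡ = k , determine (sym pos≡) (begin
      copy (h₁ j)   ≡⟨ H₁.same-copy b≡ ⟨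
      copy (h₁ j′)  ≡⟨ cong copy e ⟩
      copy (h₂ k′)  ≡⟨ H₂.same-copy (trans (cong blk (sym e)) (trans b≡ (sym (cong block pos≡)))) ⟩
      copy (h₂ k)   ∎)

    g⇒≥ : ∀ j → g (blk (h₁ j)) ≡ true → does (d ≤? toℕ j) ≡ true
    g⇒≥ j e with shared⇒ j (does⁻ (shared? _) e)
    ... | k , h≡ = dec-true (d ≤? toℕ j) (subst (d ≤_)
      (trans (sym (toℕ-e₂ k)) (trans (cong toℕ (sym (f-inj h≡))) (toℕ-e₁ j))) (m≤n+m d (toℕ k)))

    ≥⇒g : ∀ j → does (d ≤? toℕ j) ≡ true → g (blk (h₁ j)) ≡ true
    ≥⇒g j e = dec-true (shared? _) (j , refl , fromℕ< k<r , cong f (toℕ-injective (begin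
      toℕ (e₁ j)                ≡⟨ toℕ-e₁ j ⟩
      toℕ j                     ≡⟨ m∸n+n≡m (does⁻ (d ≤? toℕ j) e) ⟨
      toℕ j ∸ d + d             ≡⟨ cong (_+ d) (toℕ-fromℕ< k<r) ⟨
      toℕ (fromℕ< k<r) + d      ≡⟨ toℕ-e₂ (fromℕ< k<r) ⟨
      toℕ (e₂ (fromℕ< k<r))     ∎)))
      where
      k<r : toℕ j ∸ d < r
      k<r = ≤-<-trans (m∸n≤m (toℕ j) d) (toℕ<n j)

    pinned : ∀ b → mult b ≤ 1 → g b ≡ true
    pinned b b≤1 with block-surjective b
    ... | p , refl with H₁.pos-surjective p | H₂.pos-surjective p
    ... | j , refl | k , pos≡ = dec-true (shared? _) (j , refl , k , determine (sym pos≡)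
      (trans (zero-copy (H₁.alive j) b≤1) (sym (zero-copy (H₂.alive k)
        (subst (λ p → mult (block p) ≤ 1) (sym pos≡) b≤1)))))
      where
      zero-copy : ∀ {c m} → c < m → m ≤ 1 → c ≡ 0
      zero-copy c<m m≤1 = n≤0⇒n≡0 (s≤s⁻¹ (≤-trans c<m m≤1))

  choice-clique : Vec ℕ t → Subset n
  choice-clique c = Vec.tabulate (λ x → does (copy x ℕ.≟ lookup c (blk x)))

  ∈choice⁻ : ∀ {c x} → x ∈ choice-clique c → copy x ≡ lookup c (blk x)
  ∈choice⁻ {c} {x} x∈ = does⁻ (copy x ℕ.≟ lookup c (blk x)) (trans (sym (lookup∘tabulate _ x)) (∈⁻ x∈))

  ∈choice⁺ : ∀ {c x} → copy x ≡ lookup c (blk x) → x ∈ choice-clique c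
  ∈choice⁺ {c} {x} e = ∈⁺ (trans (lookup∘tabulate _ x) (dec-true (copy x ℕ.≟ lookup c (blk x)) e))

  module _ {c : Vec ℕ t} (c< : ∀ b → lookup c b < mult b) where

    choice-is-clique : Clique graph (choice-clique c)
    choice-is-clique {x} {y} x∈ y∈ x≢y = dec-true (adj? x y)
      ( subst (_< mult (blk x)) (sym (∈choice⁻ {c} x∈)) (c< (blk x))
      , subst (_< mult (blk y)) (sym (∈choice⁻ {c} y∈)) (c< (blk y))
      , x≢y , λ e → trans (∈choice⁻ {c} x∈) (trans (cong (lookup c) e) (sym (∈choice⁻ {c} y∈))))

    chosen : ∀ p → ∃ λ x → pos x ≡ p × x ∈ choice-clique c
    chosen p with realise p (lookup c (block p)) (c< (block p))
    ... | x , refl , copy≡ = x , refl , ∈choice⁺ {c} copy≡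

    -- Double counting of the pairs (p, `chosen p`): each position p has one chosen vertex, and each
    -- vertex x of the clique is chosen only for p = `pos x`.
    ∣choice-clique∣ : ∣ choice-clique c ∣ ≡ r
    ∣choice-clique∣ = begin
      ∣ S ∣                                    ≡⟨ ∣∣≡# S ⟩
      sum (λ x → ⟦ lookup S x ⟧)               ≡⟨ sum-cong-≗ {n} column ⟩
      sum (λ x → sum (λ p → ⟦ H p x ⟧))        ≡⟨ ∑-comm (λ x p → ⟦ H p x ⟧) ⟩
      sum (λ p → sum (λ x → ⟦ H p x ⟧))        ≡⟨ sum-cong-≗ {r} row ⟩
      # (λ (_ : Fin r) → true)                 ≡⟨ #-true {r} (λ _ → refl) ⟩
      r                                        ∎
      where
      open ≡-Reasoning
      S = choice-clique c
      H : Fin r → Fin n → Bool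
      H p x = δ (proj₁ (chosen p)) x
      row : ∀ p → sum (λ x → ⟦ H p x ⟧) ≡ 1
      row p = #-δ (proj₁ (chosen p))
      chosen-pos : ∀ {x} → x ∈ S → proj₁ (chosen (pos x)) ≡ x
      chosen-pos {x} x∈ with chosen (pos x)
      ... | y , pos≡ , y∈ = determine pos≡
        (trans (∈choice⁻ {c} y∈) (trans (cong (lookup c ∘ block) pos≡) (sym (∈choice⁻ {c} x∈))))
      column : ∀ x → ⟦ lookup S x ⟧ ≡ # (λ p → H p x)
      column x with lookup S x in e
      ... | false = sym (#-≡0 {p = λ p → H p x} λ p h → true≢false (trans (sym (∈⁻
              (subst (_∈ S) (does⁻ (proj₁ (chosen p) ≟ x) h) (proj₂ (proj₂ (chosen p)))))) e))
      ... | true = sym (trans (#-cong {p = λ p → H p x} {δ (pos x)}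
              (λ p h → dec-true (pos x ≟ p) (trans
                (cong pos (sym (does⁻ (proj₁ (chosen p) ≟ x) h))) (proj₁ (proj₂ (chosen p)))))
              (λ p h → dec-true (proj₁ (chosen p) ≟ x) (subst (λ p → proj₁ (chosen p) ≡ x)
                (does⁻ (pos x ≟ p) h) (chosen-pos (∈⁺ e))))) (#-δ (pos x)))

  choice-clique-injective : ∀ {c c′} → (∀ b → lookup c b < mult b) →
                            choice-clique c ≡ choice-clique c′ → c ≡ c′
  choice-clique-injective {c} {c′} c< e =
    trans (sym (tabulate∘lookup c)) (trans (tabulate-cong same) (tabulate∘lookup c′))
    where
    same : ∀ b → lookup c b ≡ lookup c′ b
    same b with block-surjective b
    ... | p , refl with chosen {c} c< p
    ... | x , refl , x∈ = trans (sym (∈choice⁻ {c} x∈)) (∈choice⁻ {c′} (subst (x ∈_) e x∈))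

  -- `length≤classes` with classes of size at most 1 serves as the counting principle for
  -- injections: a choice is sorted by the clique that it produces.
  choices≤#K : length (choices mult) ≤ #K r graph
  choices≤#K = ≤-trans (length≤classes class? (cliques r graph) (choices mult)
    (λ {c} c∈ → let c< = choices-< mult c∈ in
      choice-clique c , ∈cliques⁺ graph (∣choice-clique∣ {c} c<) (choice-is-clique {c} c<) , refl)
    (λ {S} _ → length-unique-const (filter⁺ (class? S) (Unique-choices mult))
      λ {c} {c′} c∈ c′∈ → let (c∈F , e) = ∈-filter⁻ (class? S) {xs = choices mult} c∈
                              (_ , e′) = ∈-filter⁻ (class? S) {xs = choices mult} c′∈
                          in choice-clique-injective (choices-< mult c∈F) (trans e (sym e′))))
    (≤-reflexive (*-identityʳ _))
    where
    class? : ∀ S c → Dec (choice-clique c ≡ S)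
    class? S c = ≡-dec _𝔹≟_ (choice-clique c) S

-- Vertices as pairs of a residue and a quotient modulo r

module Residues (r n : ℕ) .⦃ r≢0 : NonZero r ⦄ where

  q = n / r

  pos : Fin n → Fin r
  pos x = toℕ x mod r

  copy : Fin n → ℕ
  copy x = toℕ x / r

  toℕ-pos : ∀ x → toℕ (pos x) ≡ toℕ x % r
  toℕ-pos x = toℕ-fromℕ< (m%n<n (toℕ x) r)

  determine : ∀ {x y} → pos x ≡ pos y → copy x ≡ copy y → x ≡ y
  determine {x} {y} pos≡ copy≡ = toℕ-injective (begin
    toℕ x                              ≡⟨ m≡m%n+[m/n]*n (toℕ x) r ⟩
    toℕ x % r + toℕ x / r * r          ≡⟨ cong₂ (λ a b → a + b * r)
                                            (trans (sym (toℕ-pos x)) (trans (cong toℕ pos≡) (toℕ-pos y))) copy≡ ⟩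
    toℕ y % r + toℕ y / r * r          ≡⟨ m≡m%n+[m/n]*n (toℕ y) r ⟨
    toℕ y                              ∎)
    where open ≡-Reasoning

  realise : ∀ p c → c < q → ∃ λ x → pos x ≡ p × copy x ≡ c
  realise p c c<q = fromℕ< v<n , toℕ-injective (begin
      toℕ (pos (fromℕ< v<n))     ≡⟨ toℕ-pos (fromℕ< v<n) ⟩
      toℕ (fromℕ< v<n) % r       ≡⟨ cong (_% r) (toℕ-fromℕ< v<n) ⟩
      (toℕ p + c * r) % r        ≡⟨ [m+kn]%n≡m%n (toℕ p) c r ⟩
      toℕ p % r                  ≡⟨ m<n⇒m%n≡m (toℕ<n p) ⟩
      toℕ p                      ∎) , (begin
      toℕ (fromℕ< v<n) / r       ≡⟨ cong (_/ r) (toℕ-fromℕ< v<n) ⟩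
      (toℕ p + c * r) / r        ≡⟨ +-distrib-/-∣ʳ (toℕ p) (n∣m*n c) ⟩
      toℕ p / r + c * r / r      ≡⟨ cong₂ _+_ (m<n⇒m/n≡0 (toℕ<n p)) (m*n/n≡m c r) ⟩
      c                          ∎)
    where
    open ≡-Reasoning
    v<n : toℕ p + c * r < n
    v<n = ≤-trans (+-monoˡ-≤ (c * r) (toℕ<n p)) (≤-trans (*-monoˡ-≤ r c<q) (m/n*n≤m n r))

  q>0 : r ≤ n → 1 ≤ q
  q>0 = m≥n⇒m/n>0

  -- The remainder is at most r, hence at most q * r once q is positive. This is the origin of the
  -- factor 2r, raised to the exponent, in the constants of the lower bounds.
  n≤2rq : r ≤ n → n ≤ 2 * r * q
  n≤2rq r≤n = begin
    n                    ≡⟨ m≡m%n+[m/n]*n n r ⟩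
    n % r + q * r        ≤⟨ +-monoˡ-≤ (q * r) (m%n≤n n r) ⟩
    r + q * r            ≤⟨ +-monoˡ-≤ (q * r) (≤-trans (≤-reflexive (sym (*-identityˡ r))) (*-monoˡ-≤ r (q>0 r≤n))) ⟩
    q * r + q * r        ≡⟨ cong (q * r +_) (+-identityʳ (q * r)) ⟨
    2 * (q * r)          ≡⟨ cong (2 *_) (*-comm q r) ⟩
    2 * (r * q)          ≡⟨ *-assoc 2 r q ⟨
    2 * r * q            ∎
    where open ≤-Reasoning

-- The blocks of a partition

blockOf : ∀ as → Fin (sumₗ as) → Fin (length as)
blockOf (a ∷ as) p = [ (λ _ → zero) , suc ∘ blockOf as ]′ (splitAt a p)

blockOf-↑ˡ : ∀ a as i → blockOf (a ∷ as) (i ↑ˡ sumₗ as) ≡ zero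
blockOf-↑ˡ a as i rewrite splitAt-↑ˡ a i (sumₗ as) = refl

blockOf-↑ʳ : ∀ a as j → blockOf (a ∷ as) (a ↑ʳ j) ≡ suc (blockOf as j)
blockOf-↑ʳ a as j rewrite splitAt-↑ʳ a (sumₗ as) j = refl

blockOf-surjective : ∀ {as} → All (0 <_) as → ∀ b → ∃ λ p → blockOf as p ≡ b
blockOf-surjective {a ∷ as} (a>0 ∷ _) zero = fromℕ< a>0 ↑ˡ sumₗ as , blockOf-↑ˡ a as _
blockOf-surjective {a ∷ as} (_ ∷ as>0) (suc b) with blockOf-surjective as>0 b
... | p , e = a ↑ʳ p , trans (blockOf-↑ʳ a as p) (cong suc e)

#-blockOf : ∀ a as (g : Fin (length (a ∷ as)) → Bool) →
  # (g ∘ blockOf (a ∷ as)) ≡ # (λ (_ : Fin a) → g zero) + # (g ∘ suc ∘ blockOf as)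
#-blockOf a as g = trans (#-+ a (g ∘ blockOf (a ∷ as))) (cong₂ _+_
  (sum-cong-≗ {a} (λ i → cong (⟦_⟧ ∘ g) (blockOf-↑ˡ a as i)))
  (sum-cong-≗ {sumₗ as} (λ j → cong (⟦_⟧ ∘ g) (blockOf-↑ʳ a as j))))

-- Translates a set of blocks, given by g, into the sublist that `SumFree` speaks of.
subsum : ∀ as (g : Fin (length as) → Bool) → ∃ λ bs → bs ⊑ as × sumₗ bs ≡ # (g ∘ blockOf as)
subsum [] g = [] , [] , refl
subsum (a ∷ as) g with subsum as (g ∘ suc) | g zero in e
... | bs , bs⊑ , sum≡ | true = a ∷ bs , refl ∷ bs⊑ ,
      trans (cong₂ _+_ (sym (#-true {a} (λ _ → e))) sum≡) (sym (#-blockOf a as g))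
... | bs , bs⊑ , sum≡ | false = bs , a ∷ʳ bs⊑ ,
      trans (cong₂ _+_ (sym (#-≡0 {a} {λ _ → g zero} (λ _ t → true≢false (trans (sym t) e)))) sum≡) (sym (#-blockOf a as g))

-- The two lower bounds

^-distribʳ-* : ∀ b m n → (m * n) ^ b ≡ m ^ b * n ^ b
^-distribʳ-* zero m n = refl
^-distribʳ-* (suc b) m n = trans (cong (m * n *_) (^-distribʳ-* b m n)) ([m*n]*[o*p]≡[m*o]*[n*p] m n (m ^ b) (n ^ b))

-- A common frame for both constructions. With n vertices there are at least q = n / r copies of
-- each position, whence the bound on `mult`. Giving a block multiplicity 1 sacrifices a factor q in
-- the number of cliques, but then only those sets g that contain the block have to avoid the sum s.
lower : ∀ {as s} → All (0 <_) as → 2 ≤ sumₗ as → s < sumₗ as →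
        (mult : ℕ → Fin (length as) → ℕ) → (∀ {q} → 1 ≤ q → ∀ b → mult q b ≤ q) →
        (∀ q (g : Fin (length as) → Bool) → (∀ b → mult q b ≤ 1 → g b ≡ true) → # (g ∘ blockOf as) ≢ s) →
        ∀ b → (∀ q → q ^ b ≤ length (choices (mult q))) →
        ∀ n → sumₗ as ≤ n → ExLower (sumₗ as) s n b ((2 * sumₗ as) ^ b)
lower {as} as>0 r≥2 s<r mult mult≤q avoid b q^b≤ n r≤n = graph , block-B-free r≥2 s<r (avoid q) , (begin
  n ^ b                                  ≤⟨ ^-monoˡ-≤ b (n≤2rq r≤n) ⟩
  (2 * r * q) ^ b                        ≡⟨ ^-distribʳ-* b (2 * r) q ⟩
  (2 * r) ^ b * q ^ b                    ≤⟨ *-monoʳ-≤ ((2 * r) ^ b) (≤-trans (q^b≤ q) choices≤#K) ⟩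
  (2 * r) ^ b * #K r graph               ∎)
  where
  open ≤-Reasoning
  r = sumₗ as
  instance r≢0 = >-nonZero (≤-trans (s≤s z≤n) s<r)
  open Residues r n
  open BlockGraph (blockOf as) (mult q) pos copy determine
    (λ p c c< → realise p c (≤-trans c< (mult≤q (q>0 r≤n) _))) (blockOf-surjective as>0)

lower-partition : ∀ {as s} → All (0 <_) as → 2 ≤ sumₗ as → s < sumₗ as → SumFree s as →
  ∀ n → sumₗ as ≤ n → ExLower (sumₗ as) s n (length as) ((2 * sumₗ as) ^ length as)
lower-partition {as} as>0 r≥2 s<r free = lower as>0 r≥2 s<r (λ q _ → q) (λ _ _ → ≤-refl)
  (λ q g _ e → let (bs , bs⊑as , sum≡) = subsum as g in free bs bs⊑as (trans sum≡ e))
  (length as) (λ q → ≤-reflexive (sym (length-choices-const (length as) q)))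

sum-replicate-1 : ∀ d → sumₗ (replicate d 1) ≡ d
sum-replicate-1 zero = refl
sum-replicate-1 (suc d) = cong suc (sum-replicate-1 d)

-- One fixed K_{s+1} joined to d classes of isolated vertices: any two copies of K_r share the K_{s+1}.
lower-fixed : ∀ s d n → suc s + d ≤ n → 1 ≤ s → ExLower (suc s + d) s n d ((2 * (suc s + d)) ^ d)
lower-fixed s d n r≤n s≥1 = subst (λ l → ExLower (suc s + d) s n l ((2 * (suc s + d)) ^ l)) (length-replicate d)
  (subst (λ t → ExLower (suc s + t) s n (length ones) ((2 * (suc s + t)) ^ length ones)) sum-ones
    (lower (s≤s z≤n ∷ replicate⁺ d (s≤s z≤n)) (≤-trans (s≤s s≥1) (m≤m+n (suc s) _)) (m≤m+n (suc s) _)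
      mult mult≤q avoid (length ones) lots n (subst (λ t → suc s + t ≤ n) (sym sum-ones) r≤n)))
  where
  ones = replicate d 1
  sum-ones : sumₗ ones ≡ d
  sum-ones = sum-replicate-1 d
  mult : ℕ → Fin (suc (length ones)) → ℕ
  mult q zero = 1
  mult q (suc _) = q
  mult≤q : ∀ {q} → 1 ≤ q → ∀ b → mult q b ≤ q
  mult≤q q≥1 zero = q≥1
  mult≤q q≥1 (suc _) = ≤-refl
  avoid : ∀ q (g : Fin (suc (length ones)) → Bool) → (∀ b → mult q b ≤ 1 → g b ≡ true) →
          # (g ∘ blockOf (suc s ∷ ones)) ≢ s
  avoid q g pinned e = contradiction (begin
    suc s                                       ≡⟨ #-true {suc s} (λ _ → pinned zero ≤-refl) ⟨
    # (λ (_ : Fin (suc s)) → g zero)            ≤⟨ m≤m+n _ _ ⟩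
    # (λ (_ : Fin (suc s)) → g zero) + # (g ∘ suc ∘ blockOf ones)  ≡⟨ #-blockOf (suc s) ones g ⟨
    # (g ∘ blockOf (suc s ∷ ones))              ≡⟨ e ⟩
    s                                           ∎) (<-irrefl refl)
    where open ≤-Reasoning
  lots : ∀ q → q ^ length ones ≤ length (choices (mult q))
  lots q = ≤-reflexive (sym (trans (length-choices (mult q)) (trans (+-identityʳ _) (length-choices-const (length ones) q))))

-- Combining the bounds

ExLower-mono : ∀ {r s n a C C′} → C ≤ C′ → ExLower r s n a C → ExLower r s n a C′
ExLower-mono C≤ (G , free , bound) = G , free , ≤-trans bound (*-monoˡ-≤ _ C≤)

ExUpper-mono : ∀ {r s n a C C′} → C ≤ C′ → ExUpper r s n a C → ExUpper r s n a C′
ExUpper-mono C≤ h G free = ≤-trans (h G free) (*-monoˡ-≤ _ C≤)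

-- One constant has to serve both bounds, hence C + D. The threshold r is where the lower bound
-- starts, and it makes n a successor, as the upper bound requires.
combine-bounds : ∀ {r s a b} → 1 ≤ r → (∃ λ C → ∀ n → r ≤ n → ExLower r s n a C) →
                 (∃ λ C → ∀ n → ExUpper r s (suc n) b C) →
                 ∃₂ λ C N → ∀ n → N ≤ n → ExLower r s n a C × ExUpper r s n b C
combine-bounds {r} {s} {a} {b} r≥1 (C , lo) (D , hi) = C + D , r , both
  where
  both : ∀ n → r ≤ n → ExLower r s n a (C + D) × ExUpper r s n b (C + D)
  both zero r≤n = contradiction (≤-trans r≥1 r≤n) λ ()
  both (suc n) r≤n = ExLower-mono {r} {s} {a = a} (m≤m+n C D) (lo (suc n) r≤n) ,
                     ExUpper-mono {r} {s} {a = b} (m≤n+m D C) (hi n)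

theorem1p6 : ∀ (r s : ℕ) → 2 ≤ s → s < r →
    (2 * s + 1 ≤ r →
    ∃₂ λ (C N : ℕ) → ∀ n → N ≤ n →
    ExLower r s n (r ∸ s ∸ 1) C × ExUpper r s n (r ∸ s ∸ 1) C)
    ×
    (r ≤ 2 * s → ∀ (β : ℕ) → IsBeta r s β →
    ∃₂ λ (C N : ℕ) → ∀ n → N ≤ n →
    ExLower r s n β C × ExUpper r s n s C)
theorem1p6 r s s≥2 s<r = large , small
  where
  r≥2 : 2 ≤ r
  r≥2 = ≤-trans s≥2 (<⇒≤ s<r)
  d = r ∸ s ∸ 1
  r≡ : suc s + d ≡ r
  r≡ = trans (cong (suc s +_) (∸-+-assoc r s 1)) (trans (cong (λ t → suc s + (r ∸ t)) (+-comm s 1)) (m+[n∸m]≡n s<r))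

  large : 2 * s + 1 ≤ r → _
  large 2s+1≤r = combine-bounds {s = s} {a = d} {b = d} (<⇒≤ r≥2)
    ((2 * r) ^ d , λ n r≤n → subst (λ t → ExLower t s n d ((2 * t) ^ d)) r≡
      (lower-fixed s d n (subst (_≤ n) (sym r≡) r≤n) (<⇒≤ s≥2)))
    -- The case m = d: r ≥ 2s + 1 amounts to s ≤ d, and r ≤ m + 1 + s is an equality.
    (upper s<r s≤d (≤-reflexive (trans (sym r≡) (cong suc (+-comm s d)))))
    where
    open ≤-Reasoning
    s≤d : s ≤ d
    s≤d = +-cancelˡ-≤ (suc s) s d (begin
      suc s + s     ≡⟨ cong (λ t → suc (s + t)) (+-identityʳ s) ⟨
      suc (2 * s)   ≡⟨ +-comm 1 (2 * s) ⟩
      2 * s + 1     ≤⟨ 2s+1≤r ⟩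
      r             ≡⟨ r≡ ⟨
      suc s + d     ∎)

  small : r ≤ 2 * s → ∀ β → IsBeta r s β → _
  small r≤2s β ((as , (_ , as>0 , refl) , free , refl) , _) = combine-bounds {s = s} {a = length as} {b = s} (<⇒≤ r≥2)
    ((2 * r) ^ length as , lower-partition as>0 r≥2 s<r free)
    -- The case m = s, where the requirement is r ≤ 2s + 1.
    (upper s<r ≤-refl (≤-trans r≤2s (≤-trans (≤-reflexive (cong (s +_) (+-identityʳ s))) (n≤1+n (s + s)))))
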